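{- Let $\kappa$ be a regular uncountable cardinal and $\lambda>\kappa$ a cardinal. Suppose $\theta$ is an infinite cardinal $<\kappa$ such that $\kappa\to(\kappa,\theta)^2$. Then $H^+\xrightarrow{\kappa}(H^+,\theta+1)^2$ for every ideal $H$ on $P_\kappa(\lambda)$ such that $\mathrm{cof}(H)<\mathbf{cov}(\mathbf{M}_{\kappa,\kappa})$.
   Context: For a cardinal $\mu$ and a set $A$, $P_\mu(A)=\{a\subseteq A:|a|<\mu\}$. An ideal on an infinite set $S$ is a collection $K$ of subsets of $S$ containing all singletons, closed under subsets and finite unions, with $S\notin K$; $K^+=P(S)\setminus K$; $\mathrm{cof}(K)$ is the least cardinality of an $X\subseteq K$ with $K=\bigcup_{A\in X}P(A)$. $I_{\kappa,\lambda}$ is the set of all $A\subseteq P_\kappa(\lambda)$ such that $A\cap\{b\in P_\kappa(\lambda):a\subseteq b\}=\emptyset$ for some $a\in P_\kappa(\lambda)$. "Ideal on $P_\kappa(\lambda)$" always means an ideal $H$ on $P_\kappa(\lambda)$ that is $\kappa$-complete (closed under unions of fewer than $\kappa$ members) and fine ($I_{\kappa,\lambda}\subseteq H$). $\kappa\to(\kappa,\alpha)^2$ ($\alpha\ge 2$ an ordinal) means: for every $f:\{(\xi,\eta)\in\kappa\times\kappa:\xi<\eta\}\to 2$ there is $A\subseteq\kappa$ such that either $A$ has order type $\kappa$ and $f$ is identically $0$ on $[A]^2=\{(\xi,\eta)\in A\times A:\xi<\eta\}$, or $A$ has order type $\alpha$ and $f$ is identically $1$ on $[A]^2$. For $A\subseteq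 P_\kappa(\lambda)$, $[A]^2_\kappa=\{(\bigcup(a\cap\kappa),b):a,b\in A,\ \bigcup(a\cap\kappa)<\bigcup(b\cap\kappa)\}$. For $a,b\in P_\kappa(\lambda)$, $a\prec b$ means $a\subseteq b$ and $\bigcup(a\cap\kappa)<\bigcup(b\cap\kappa)$. For an ideal $H$ on $P_\kappa(\lambda)$ and an ordinal $\alpha$, $H^+\xrightarrow{\kappa}(H^+,\alpha)^2$ means: for every $F:[P_\kappa(\lambda)]^2_\kappa\to2$ and every $A\in H^+$ there is $B\subseteq A$ such that either $B\in H^+$ and $F$ is identically $0$ on $[B]^2_\kappa$, or $(B,\prec)$ has order type $\alpha$ and $F$ is identically $1$ on $[B]^2_\kappa$. $\mathbf{cov}(\mathbf{M}_{\kappa,\kappa})$: give ${}^\kappa2$ the topology whose basic open sets are $\emptyset$ and $O_s=\{f\in{}^\kappa2:s\subseteq f\}$ for $s\in\bigcup\{{}^a2:a\in P_\kappa(\kappa)\}$. $\mathbf{M}_{\kappa,\kappa}$ is the set of all $W\subseteq{}^\kappa2$ such that $W\cap\bigcap X=\emptyset$ for some collection $X$ of dense open sets with $0<|X|\le\kappa$. $\mathbf{cov}(\mathbf{M}_{\kappa,\kappa})$ is the least cardinality of a $Y\subseteq\mathbf{M}_{\kappa,\kappa}$ with $\bigcup Y={}^\kappa2$. -}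

module Defs where

open import Level using (Level; suc; _⊔_)
open import Data.Bool using (Bool; true; false; T; _∨_)
open import Data.Nat using (ℕ)
open import Data.Product using (∃-syntax; Σ-syntax; _×_; _,_)
open import Data.Refinement using (Refinement; Refinement-syntax; value; value-injective; _,_)
open import Data.Sum using (_⊎_)
open import Function.Bundles using (_↣_; _⤖_; _⇔_)
open import Induction.WellFounded using (WellFounded)
open import Relation.Binary.Core using (Rel)
open import Relation.Binary.Definitions using (Tri; tri<; tri≈; tri>)
open import Relation.Binary.Morphism.Structures using (IsOrderIsomorphism)
open import Relation.Binary.PropositionalEquality using (_≡_; refl; cong; isEquivalence; resp₂)
open import Relation.Binary.Structures using (IsStrictTotalOrder)
open import Relation.Nullary using (¬_)
open import Relation.Unary using (Pred)
import Relation.Binary.Construct.On as On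

------------------------------------------------------------------------
-- Subsets and cardinalities

-- The definitions are meant to be read in classical mathematics, i.e. in the
-- presence of excluded middle and function extensionality.  There Bool is the
-- type of truth values, so that A → Bool is the full, extensional power set
-- of A, and it stays in the universe of A.

𝒫 : ∀ {a} → Set a → Set a
𝒫 A = A → Bool

infix 4 _∈_ _⊆_

_∈_ : ∀ {a} {A : Set a} → A → 𝒫 A → Set
x ∈ P = T (P x)

_⊆_ : ∀ {a} {A : Set a} → 𝒫 A → 𝒫 A → Set a
P ⊆ Q = ∀ x → x ∈ P → x ∈ Q

-- The proof component of a Refinement is irrelevant, so elements of
-- El P are equal as soon as the underlying elements of A are.

El : ∀ {a} {A : Set a} → 𝒫 A → Set a
El {A = A} P = [ x ∈ A ∣ x ∈ P ]

-- |A| < |B|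

_⟪_ : ∀ {a b} → Set a → Set b → Set (a ⊔ b)
A ⟪ B = (A ↣ B) × ¬ (B ↣ A)

infix 4 _⟪_

𝒫< : ∀ {m a} → Set m → Set a → Set (m ⊔ a)
𝒫< M A = [ P ∈ 𝒫 A ∣ El P ⟪ M ]

-- μ has the least cardinality among the subsets X of A satisfying C.

IsLeastCardinality : ∀ {a c m} {A : Set a} → Pred (𝒫 A) c → Set m → Set (a ⊔ c ⊔ m)
IsLeastCardinality C μ = (∃[ X ] C X × (El X ⤖ μ)) × (∀ X → C X → μ ↣ El X)

------------------------------------------------------------------------
-- Ordinals and cardinals

-- An ordinal is represented by a well-ordered set.  As with von Neumann
-- ordinals, an element ξ of an ordinal O is identified with the ordinal
-- O ↓ ξ of its predecessors.

record Ordinal ℓ : Set (suc ℓ) where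
  infix 4 _<_
  field
    Carrier            : Set ℓ
    _<_                : Rel Carrier ℓ
    isStrictTotalOrder : IsStrictTotalOrder _≡_ _<_
    wellFounded        : WellFounded _<_

  open IsStrictTotalOrder isStrictTotalOrder public using (irrefl; trans; compare)

⟨_⟩ : ∀ {ℓ} → Ordinal ℓ → Set ℓ
⟨ O ⟩ = Ordinal.Carrier O

restrict : ∀ {ℓ} (O : Ordinal ℓ) → Pred ⟨ O ⟩ ℓ → Ordinal ℓ
restrict O P = record
  { Carrier            = Refinement ⟨ O ⟩ P
  ; _<_                = λ x y → value x < value y
  ; isStrictTotalOrder = record
    { isStrictPartialOrder = record
      { isEquivalence = isEquivalence
      ; irrefl        = λ { refl → irrefl refl }
      ; trans         = trans
      ; <-resp-≈      = resp₂ _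
      }
    ; compare = λ x y → lift (compare (value x) (value y))
    }
  ; wellFounded = On.wellFounded value wellFounded
  }
  where
  open Ordinal O
  lift : ∀ {x y : Refinement ⟨ O ⟩ P} →
         Tri (value x < value y) (value x ≡ value y) (value y < value x) →
         Tri (value x < value y) (x ≡ y) (value y < value x)
  lift (tri< a ¬b ¬c) = tri< a (λ e → ¬b (cong value e)) ¬c
  lift (tri≈ ¬a b ¬c) = tri≈ ¬a (value-injective b) ¬c
  lift (tri> ¬a ¬b c) = tri> ¬a (λ e → ¬b (cong value e)) c

infixl 8 _↓_ _↓+1_

_↓_ : ∀ {ℓ} (O : Ordinal ℓ) → ⟨ O ⟩ → Ordinal ℓ
O ↓ ξ = restrict O (λ x → x < ξ)
  where open Ordinal O

-- ξ + 1 = ξ ∪ {ξ}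

_↓+1_ : ∀ {ℓ} (O : Ordinal ℓ) → ⟨ O ⟩ → Ordinal ℓ
O ↓+1 ξ = restrict O (λ x → x < ξ ⊎ x ≡ ξ)
  where open Ordinal O

IsCardinal : ∀ {ℓ} → Ordinal ℓ → Set ℓ
IsCardinal O = ∀ ξ → ¬ (⟨ O ⟩ ↣ ⟨ O ↓ ξ ⟩)

IsInfiniteCardinal : ∀ {ℓ} → Ordinal ℓ → Set ℓ
IsInfiniteCardinal O = IsCardinal O × (ℕ ↣ ⟨ O ⟩)

IsUncountableCardinal : ∀ {ℓ} → Ordinal ℓ → Set ℓ
IsUncountableCardinal O = IsCardinal O × (ℕ ⟪ ⟨ O ⟩)

-- Every cofinal subset has full cardinality, i.e. cf(O) = |O|.

IsRegular : ∀ {ℓ} → Ordinal ℓ → Set ℓ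
IsRegular O = ∀ (A : 𝒫 ⟨ O ⟩) →
              (∀ ξ → ∃[ η ] η ∈ A × (ξ < η ⊎ ξ ≡ η)) →
              ⟨ O ⟩ ↣ El A
  where open Ordinal O

-- ξ = ⋃ X for a set X of ordinals: the elements of ξ are the elements of
-- elements of X.  In particular ⋃ ∅ is the least ordinal.

IsSup : ∀ {ℓ p} (O : Ordinal ℓ) → Pred ⟨ O ⟩ p → Pred ⟨ O ⟩ (ℓ ⊔ p)
IsSup O X ξ = ∀ η → η < ξ ⇔ (∃[ x ] X x × η < x)
  where open Ordinal O

HasOrderType : ∀ {a b r} {A : Set a} → Rel A r → 𝒫 A → Ordinal b → Set (a ⊔ b ⊔ r)
HasOrderType _R_ B α =
  ∃[ f ] IsOrderIsomorphism {A = El B} {B = ⟨ α ⟩} _≡_ _≡_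
           (λ x y → value x R value y) (Ordinal._<_ α) f

------------------------------------------------------------------------
-- Partition relation for ordinals

-- The colouring F, whose domain is the set E, is constant with value i on D.

Constantly : ∀ {a e d} {A : Set a} {E : Pred A e} →
             (Refinement A E → Bool) → Bool → Pred A d → Set (a ⊔ e ⊔ d)
Constantly F i D = ∀ p → D (value p) → F p ≡ i

IncreasingPairs : ∀ {ℓ} (κ : Ordinal ℓ) → 𝒫 ⟨ κ ⟩ → Pred (⟨ κ ⟩ × ⟨ κ ⟩) ℓ
IncreasingPairs κ A (ξ , η) = ξ ∈ A × η ∈ A × ξ < η
  where open Ordinal κ

_⟶⟨κ,_⟩² : ∀ {ℓ a} → Ordinal ℓ → Ordinal a → Set (ℓ ⊔ a)
κ ⟶⟨κ, α ⟩² =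
  ∀ (f : Refinement (⟨ κ ⟩ × ⟨ κ ⟩) (λ (ξ , η) → ξ < η) → Bool) →
  ∃[ A ] ((HasOrderType _<_ A κ × Constantly f false (IncreasingPairs κ A))
        ⊎ (HasOrderType _<_ A α × Constantly f true  (IncreasingPairs κ A)))
  where open Ordinal κ

------------------------------------------------------------------------
-- Ideals

record IsIdeal {s} {S : Set s} (K : 𝒫 (𝒫 S)) : Set s where
  field
    singletons : ∀ x A → (∀ y → y ∈ A ⇔ y ≡ x) → A ∈ K
    downward   : ∀ {A B} → A ⊆ B → B ∈ K → A ∈ K
    unions     : ∀ {A B} → A ∈ K → B ∈ K → (λ x → A x ∨ B x) ∈ K
    proper     : ¬ ((λ _ → true) ∈ K)

-- K is the union of the power sets of the members of X.

Generates : ∀ {s} {S : Set s} → 𝒫 (𝒫 S) → Pred (𝒫 (𝒫 S)) s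
Generates K X = X ⊆ K × (∀ B → B ∈ K ⇔ (∃[ A ] A ∈ X × B ⊆ A))

IsCof : ∀ {s m} {S : Set s} → 𝒫 (𝒫 S) → Set m → Set (s ⊔ m)
IsCof K μ = IsLeastCardinality (Generates K) μ

------------------------------------------------------------------------
-- P_κ(λ), where λ is the ordinal Λ and κ is an element of it

module _ {ℓ} (Λ : Ordinal ℓ) (κ : ⟨ Λ ⟩) where
  open Ordinal Λ

  infix 4 _≺_

  Pκλ : Set ℓ
  Pκλ = 𝒫< ⟨ Λ ↓ κ ⟩ ⟨ Λ ⟩

  I[κ,λ] : Pred (𝒫 Pκλ) ℓ
  I[κ,λ] A = Σ[ a ∈ Pκλ ] (∀ (b : Pκλ) → value a ⊆ value b → ¬ (b ∈ A))

  record IsIdealOnPκλ (H : 𝒫 (𝒫 Pκλ)) : Set ℓ where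
    field
      isIdeal  : IsIdeal H
      complete : ∀ (X : 𝒫 (𝒫 Pκλ)) → X ⊆ H → El X ⟪ ⟨ Λ ↓ κ ⟩ →
                 ∀ U → (∀ b → b ∈ U ⇔ (∃[ A ] A ∈ X × b ∈ A)) → U ∈ H
      fine     : ∀ A → I[κ,λ] A → A ∈ H

  -- ξ = ⋃ (a ∩ κ)

  IsTrace : Pκλ → Pred ⟨ Λ ⟩ ℓ
  IsTrace a = IsSup Λ (λ x → x ∈ value a × x < κ)

  TracePairs : 𝒫 Pκλ → Pred (⟨ Λ ⟩ × Pκλ) ℓ
  TracePairs A (ξ , b) =
    b ∈ A × (∃[ a ] a ∈ A × IsTrace a ξ) × (∃[ ζ ] IsTrace b ζ × ξ < ζ)

  _≺_ : Rel Pκλ ℓ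
  a ≺ b = value a ⊆ value b × (∃[ ξ ] ∃[ ζ ] IsTrace a ξ × IsTrace b ζ × ξ < ζ)

  _⁺⟶⟨H⁺,_⟩² : ∀ {a} → 𝒫 (𝒫 Pκλ) → Ordinal a → Set (ℓ ⊔ a)
  H ⁺⟶⟨H⁺, α ⟩² =
    ∀ (F : Refinement (⟨ Λ ⟩ × Pκλ) (TracePairs (λ _ → true)) → Bool) →
    ∀ A → ¬ (A ∈ H) →
    ∃[ B ] B ⊆ A ×
      ( (¬ (B ∈ H)            × Constantly F false (TracePairs B))
      ⊎ (HasOrderType _≺_ B α × Constantly F true  (TracePairs B)))

------------------------------------------------------------------------
-- The space ^κ2 and the covering number of its meagre ideal

module _ {ℓ} (κ : Ordinal ℓ) where

  Space : Set ℓ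
  Space = ⟨ κ ⟩ → Bool

  -- Pairs (a , s) with a ∈ P_κ(κ) and s : a → 2.

  Condition : Set ℓ
  Condition = Σ[ a ∈ 𝒫< ⟨ κ ⟩ ⟨ κ ⟩ ] (El (value a) → Bool)

  BasicOpen : Condition → Pred Space ℓ
  BasicOpen (a , s) f = ∀ x → f (value x) ≡ s x

  IsOpen : Pred (𝒫 Space) ℓ
  IsOpen W = ∀ f → f ∈ W → ∃[ c ] BasicOpen c f × (∀ g → BasicOpen c g → g ∈ W)

  IsDense : Pred (𝒫 Space) ℓ
  IsDense W = ∀ V → IsOpen V → (∃[ f ] f ∈ V) → ∃[ f ] f ∈ V × f ∈ W

  IsMeagre : Pred (𝒫 Space) ℓ
  IsMeagre W = ∃[ X ] (∃[ D ] D ∈ X) × (El X ↣ ⟨ κ ⟩)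
                    × (∀ D → D ∈ X → IsOpen D × IsDense D)
                    × (∀ f → f ∈ W → ¬ (∀ D → D ∈ X → f ∈ D))

  IsMeagreCover : Pred (𝒫 (𝒫 Space)) ℓ
  IsMeagreCover Y = (∀ W → W ∈ Y → IsMeagre W) × (∀ f → ∃[ W ] W ∈ Y × f ∈ W)

  IsCovM : ∀ {m} → Set m → Set (ℓ ⊔ m)
  IsCovM ν = IsLeastCardinality IsMeagreCover ν

module Submission where

open import Defs
open import Axiom.ExcludedMiddle using (ExcludedMiddle)
open import Axiom.Extensionality.Propositional using (Extensionality)
open import Data.Bool using (Bool; true; false; T; not)
open import Data.Bool.Properties using (T-∨; T-≡)
open import Data.Empty using (⊥-elim)
open import Data.Fin as Fin using (Fin)
open import Data.Fin.Properties as Fin using (injective⇒≤; combine-injective)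
open import Data.Irrelevant using ([_])
open import Data.Nat as ℕ using (ℕ)
import Data.Nat.Induction as ℕ
import Data.Nat.Properties as ℕ
open import Data.Product using (∃; ∃-syntax; Σ-syntax; _×_; _,_; proj₁; proj₂)
open import Data.Product.Function.NonDependent.Propositional using (_×-↣_)
open import Data.Product.Properties using (,-injectiveˡ; ,-injectiveʳ)
open import Data.Product.Relation.Binary.Lex.Strict using (×-Lex; ×-wellFounded)
open import Data.Refinement using (Refinement; value; value-injective; _,_)
open import Data.Sum using (_⊎_; inj₁; inj₂; [_,_]′)
open import Data.Sum.Properties using (inj₁-injective; inj₂-injective)
open import Data.Sum.Relation.Binary.LeftOrder
  using (_⊎-<_; ₁∼₁; ₂∼₂; ⊎-<-wellFounded; ⊎-<-asymmetric; ⊎-<-transitive; ⊎-<-trichotomous)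
open import Data.Sum.Relation.Binary.Pointwise using (Pointwise; Pointwise-≡⇒≡; ≡⇒Pointwise-≡)
open import Data.Unit using (tt)
open import Function using (_∘_; Injective)
open import Function.Bundles using (_↣_; mk↣; Injection; mk⇔; module Equivalence; module Bijection)
open import Function.Construct.Composition using (_↣-∘_)
open import Induction.WellFounded using (WellFounded; module All; module FixPoint)
open import Level using (_⊔_) renaming (suc to lsuc)
open import Relation.Binary.Core using (Rel)
open import Relation.Binary.Definitions using (Tri; tri<; tri≈; tri>)
open import Relation.Binary.Morphism.Structures using (IsOrderIsomorphism)
open import Relation.Binary.PropositionalEquality renaming (trans to ≡-trans)
open import Relation.Nullary
  using (¬_; Dec; yes; no; contradiction; ⌊_⌋; toWitness; fromWitness; recompute; decidable-stable)
open import Relation.Unary using (Pred)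
import Relation.Binary.Construct.On as On

open Injection using (to; injective)

-- Write τ(b) for ⋃(b ∩ κ) and r ◁ b for "r ≺ b, and the pair of r and b has
-- colour 1", and suppose that no positive subset of A is homogeneous for 0.
-- Whether b extends a set homogeneous for 0 depends only on the set t ⊆ κ of
-- its traces.  Hence, as cof(H) < cov(M), a generic t shows that every P ⊆ A
-- contains fewer than κ many points r, with different traces, such that almost
-- every b ∈ P satisfies r ◁ b for one of them (for P ∈ H this is trivial).
-- Iterating this yields a tree of sequences increasing for ◁ in which every
-- node has fewer than κ children, and such that almost every b ∈ A follows a
-- branch through the first i levels, provided that the levels below i have
-- fewer than κ nodes.  If i < θ were a limit level with κ many nodes, then
-- Sierpiński's colouring of its lexicographic ordering would contradict
-- κ → (κ,θ)².  So some b ∈ A lies above a branch of length θ, and the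
-- branch together with b is homogeneous for 1.

module Classical (em : ∀ {a} → ExcludedMiddle a) (ext : ∀ {a b} → Extensionality a b) where

  -- Classical choice and well-founded recursion.

  abstract

    byContradiction : ∀ {p} {P : Set p} → ¬ ¬ P → P
    byContradiction = decidable-stable em

    counterexample : ∀ {a p} {A : Set a} {P : Pred A p} → ¬ (∀ x → P x) → ∃[ x ] ¬ P x
    counterexample ¬∀ = byContradiction λ ¬∃ → ¬∀ λ x → byContradiction λ ¬Px → ¬∃ (x , ¬Px)

    set : ∀ {a p} {A : Set a} → Pred A p → 𝒫 A
    set P x = ⌊ em {P = P x} ⌋

    ∈-set⁺ : ∀ {a p} {A : Set a} {P : Pred A p} {x} → P x → x ∈ set P
    ∈-set⁺ = fromWitness

    ∈-set⁻ : ∀ {a p} {A : Set a} {P : Pred A p} {x} → x ∈ set P → P x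
    ∈-set⁻ = toWitness

    -- The irrelevant proof is recovered by `recompute`, every type being decidable here.
    holds : ∀ {a p} {A : Set a} {P : Pred A p} (x : Refinement A P) → P (value x)
    holds (_ , [ p ]) = recompute em p

    -- Excluded middle decides the type `∃ P` itself, and a positive answer carries a witness; this
    -- yields a choice operator. The default makes it total.
    chooseOr : ∀ {a p} {A : Set a} → A → Pred A p → A
    chooseOr d P with em {P = ∃ P}
    ... | yes (x , _) = x
    ... | no _        = d

    chooseOr-satisfies : ∀ {a p} {A : Set a} (d : A) (P : Pred A p) → ∃ P → P (chooseOr d P)
    chooseOr-satisfies d P e with em {P = ∃ P}
    ... | yes (_ , p) = p
    ... | no ¬e       = contradiction e ¬e

  module _ {a r} {W : Set a} {_<_ : Rel W r} (wf : WellFounded _<_) where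

    abstract

      least : ∀ {p} {P : Pred W p} → ∃ P → ∃[ x ] P x × (∀ y → y < x → ¬ P y)
      least {P = P} (x , p) = All.wfRec wf _ (λ x → P x → ∃[ x ] P x × (∀ y → y < x → ¬ P y)) step x p
        where
        step : ∀ x → (∀ {y} → y < x → P y → ∃[ x ] P x × (∀ y → y < x → ¬ P y)) →
               P x → ∃[ x ] P x × (∀ y → y < x → ¬ P y)
        step x ih p with em {P = ∃[ y ] y < x × P y}
        ... | yes (y , y<x , q) = ih y<x q
        ... | no none           = x , p , λ y y<x q → none (y , y<x , q)

      recursion : ∀ {c} {C : Set c} (step : ∀ w → (∀ v → v < w → C) → C) →
                  Σ[ g ∈ (W → C) ] (∀ w → g w ≡ step w (λ v _ → g v))
      recursion {C = C} step =
        All.wfRec wf _ (λ _ → C) f , λ w → FixPoint.unfold-wfRec wf (λ _ → C) f f-ext {w}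
        where
        f : ∀ w → (∀ {v} → v < w → C) → C
        f w ih = step w (λ v v<w → ih {v} v<w)
        f-ext : ∀ w {ih ih′ : ∀ {v} → v < w → C} → (∀ {v} v<w → ih {v} v<w ≡ ih′ v<w) → f w ih ≡ f w ih′
        f-ext w eq = cong (step w) (ext λ v → ext λ v<w → eq v<w)

      -- Recursion chooses at each stage a value different from all earlier ones; distinct indices
      -- are comparable, hence receive distinct values. A bare well-founded relation is used so that
      -- pairs ordered through a key are covered.
      greedy : ∀ {c q} {C : Set c} {Q : Pred C q} → C →
               (∀ v w → v ≢ w → v < w ⊎ w < v) →
               (∀ w (e : W → C) → ∃[ x ] Q x × (∀ v → v < w → e v ≢ x)) →
               Σ[ e ∈ (W → C) ] (∀ w → Q (e w)) × Injective _≡_ _≡_ e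
      greedy {c} {q} {C} {Q} d total fresh = e , (λ w → proj₁ (e-fresh w)) , inj
        where
        New : ∀ w → (∀ v → v < w → C) → Pred C (a ⊔ r ⊔ c ⊔ q)
        New w ih x = Q x × (∀ v v<w → ih v v<w ≢ x)
        rec : Σ[ g ∈ (W → C) ] (∀ w → g w ≡ chooseOr d (New w (λ v _ → g v)))
        rec = recursion (λ w ih → chooseOr d (New w ih))
        e : W → C
        e = proj₁ rec
        e-fresh : ∀ w → New w (λ v _ → e v) (e w)
        e-fresh w = subst (New w (λ v _ → e v)) (sym (proj₂ rec w)) (chooseOr-satisfies d _ (fresh w e))
        inj : ∀ {v w} → e v ≡ e w → v ≡ w
        inj {v} {w} eq = byContradiction λ v≢w →
          [ (λ v<w → proj₂ (e-fresh w) v v<w eq) , (λ w<v → proj₂ (e-fresh v) w w<v (sym eq)) ]′ (total v w v≢w)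

  -- Well-ordered sets.

  module Order {ℓ} (O : Ordinal ℓ) where
    open Ordinal O public

    infix 4 _≤_
    _≤_ : Rel ⟨ O ⟩ ℓ
    x ≤ y = x < y ⊎ x ≡ y

    ≮⇒≥ : ∀ {x y} → ¬ (x < y) → y ≤ x
    ≮⇒≥ {x} {y} x≮y with compare x y
    ... | tri< x<y _ _ = contradiction x<y x≮y
    ... | tri≈ _ x≡y _ = inj₂ (sym x≡y)
    ... | tri> _ _ y<x = inj₁ y<x

    <-≤-trans : ∀ {x y z} → x < y → y ≤ z → x < z
    <-≤-trans x<y (inj₁ y<z)  = trans x<y y<z
    <-≤-trans x<y (inj₂ refl) = x<y

    ≤-<-trans : ∀ {x y z} → x ≤ y → y < z → x < z
    ≤-<-trans (inj₁ x<y)  y<z = trans x<y y<z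
    ≤-<-trans (inj₂ refl) y<z = y<z

    ≤-trans : ∀ {x y z} → x ≤ y → y ≤ z → x ≤ z
    ≤-trans x≤y (inj₁ y<z)  = inj₁ (≤-<-trans x≤y y<z)
    ≤-trans x≤y (inj₂ refl) = x≤y

    ≤⇒≯ : ∀ {x y} → x ≤ y → ¬ (y < x)
    ≤⇒≯ x≤y y<x = irrefl refl (≤-<-trans x≤y y<x)

    ≢⇒<⊎> : ∀ x y → x ≢ y → x < y ⊎ y < x
    ≢⇒<⊎> x y x≢y with compare x y
    ... | tri< x<y _ _ = inj₁ x<y
    ... | tri≈ _ x≡y _ = contradiction x≡y x≢y
    ... | tri> _ _ y<x = inj₂ y<x

    upperBound : ∀ x y → ∃[ z ] x ≤ z × y ≤ z
    upperBound x y with compare x y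
    ... | tri< x<y _ _ = y , inj₁ x<y , inj₂ refl
    ... | tri≈ _ x≡y _ = y , inj₂ x≡y , inj₂ refl
    ... | tri> _ _ y<x = x , inj₂ refl , inj₁ y<x

    noLast⇒ℕ↣ : ⟨ O ⟩ → (∀ x → ∃[ y ] x < y) → ℕ ↣ ⟨ O ⟩
    noLast⇒ℕ↣ x₀ next = mk↣ {to = f} λ {m} {n} → f-injective m n
      where
      f : ℕ → ⟨ O ⟩
      f ℕ.zero    = x₀
      f (ℕ.suc n) = proj₁ (next (f n))
      f-mono : ∀ {m n} → m ℕ.<′ n → f m < f n
      f-mono ℕ.<′-base      = proj₂ (next _)
      f-mono (ℕ.<′-step lt) = trans (f-mono lt) (proj₂ (next _))
      f-injective : ∀ m n → f m ≡ f n → m ≡ n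
      f-injective m n eq with ℕ.<-cmp m n
      ... | tri< lt _ _ = contradiction (f-mono (ℕ.<⇒<′ lt)) (irrefl eq)
      ... | tri≈ _ eq _ = eq
      ... | tri> _ _ gt = contradiction (f-mono (ℕ.<⇒<′ gt)) (irrefl (sym eq))

  -- Cardinal arithmetic: squares of infinite sets.

  -- Gödel's ordering of the pairs by their maximum.

  module _ {ℓ} (O : Ordinal ℓ) where
    open Order O

    abstract

      square↣ : ⟨ O ⟩ →
                (∀ m (h : ⟨ O ⟩ → ⟨ O ⟩ × ⟨ O ⟩) → Injective _≡_ _≡_ h →
                  ¬ (∀ x → proj₁ (h x) ≤ m × proj₂ (h x) ≤ m)) →
                (⟨ O ⟩ × ⟨ O ⟩) ↣ ⟨ O ⟩
      square↣ d noSegment = mk↣ (proj₂ (proj₂ e))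
        where
        max : ⟨ O ⟩ → ⟨ O ⟩ → ⟨ O ⟩
        max x y = proj₁ (upperBound x y)
        -- The maximum comes first, so that all predecessors of a pair lie in the square of a closed
        -- initial segment {x ≤ m}.
        key : ⟨ O ⟩ × ⟨ O ⟩ → ⟨ O ⟩ × (⟨ O ⟩ × ⟨ O ⟩)
        key (x , y) = max x y , x , y
        _⊏_ : Rel (⟨ O ⟩ × (⟨ O ⟩ × ⟨ O ⟩)) ℓ
        _⊏_ = ×-Lex _≡_ _<_ (×-Lex _≡_ _<_ _<_)
        total : ∀ p q → p ≢ q → key p ⊏ key q ⊎ key q ⊏ key p
        total p@(x , y) q@(x′ , y′) p≢q with compare (max x y) (max x′ y′)
        ... | tri< lt _ _ = inj₁ (inj₁ lt)
        ... | tri> _ _ gt = inj₂ (inj₁ gt)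
        ... | tri≈ _ m≡m′ _ with compare x x′
        ...   | tri< lt _ _ = inj₁ (inj₂ (m≡m′ , inj₁ lt))
        ...   | tri> _ _ gt = inj₂ (inj₂ (sym m≡m′ , inj₁ gt))
        ...   | tri≈ _ x≡x′ _ with ≢⇒<⊎> y y′ (λ y≡y′ → p≢q (cong₂ _,_ x≡x′ y≡y′))
        ...     | inj₁ lt = inj₁ (inj₂ (m≡m′ , inj₂ (x≡x′ , lt)))
        ...     | inj₂ gt = inj₂ (inj₂ (sym m≡m′ , inj₂ (sym x≡x′ , gt)))
        below : ∀ q p → key q ⊏ key p → let m = max (proj₁ p) (proj₂ p) in proj₁ q ≤ m × proj₂ q ≤ m
        below (x , y) (x′ , y′) lt with upperBound x y
        ... | m , x≤m , y≤m = ≤-trans x≤m (m≤m′ lt) , ≤-trans y≤m (m≤m′ lt)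
          where
          m≤m′ : ∀ {m m′} {r r′ : ⟨ O ⟩ × ⟨ O ⟩} → (m , r) ⊏ (m′ , r′) → m ≤ m′
          m≤m′ (inj₁ lt)       = inj₁ lt
          m≤m′ (inj₂ (eq , _)) = inj₂ eq
        fresh : ∀ p (e : ⟨ O ⟩ × ⟨ O ⟩ → ⟨ O ⟩) →
                ∃[ x ] x ≡ x × (∀ q → key q ⊏ key p → e q ≢ x)
        -- If the earlier pairs used up all of `O`, choosing preimages under `e` would inject `O`
        -- into such a square.
        fresh p e = byContradiction λ none →
          let onto : ∀ x → ∃[ q ] key q ⊏ key p × e q ≡ x
              onto x = byContradiction λ ¬q → none (x , refl , λ q lt eq → ¬q (q , lt , eq))
          in noSegment _ (λ x → proj₁ (onto x))
               (λ {x} {y} eq → ≡-trans (sym (proj₂ (proj₂ (onto x))))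
                                 (≡-trans (cong e eq) (proj₂ (proj₂ (onto y)))))
               (λ x → below (proj₁ (onto x)) p (proj₁ (proj₂ (onto x))))
        e : Σ[ e ∈ (⟨ O ⟩ × ⟨ O ⟩ → ⟨ O ⟩) ] (∀ p → e p ≡ e p) × Injective _≡_ _≡_ e
        e = greedy (On.wellFounded key (×-wellFounded wellFounded (×-wellFounded wellFounded wellFounded)))
                   d total fresh

  clamp : ∀ n → ℕ → Fin (ℕ.suc n)
  clamp n k with k ℕ.≤? n
  ... | yes k≤n = Fin.fromℕ< (ℕ.s≤s k≤n)
  ... | no _    = Fin.zero

  clamp-injective : ∀ n {k l} → k ℕ.≤ n → l ℕ.≤ n → clamp n k ≡ clamp n l → k ≡ l
  clamp-injective n {k} {l} k≤n l≤n eq with k ℕ.≤? n | l ℕ.≤? n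
  ... | no k≰n | _      = contradiction k≤n k≰n
  ... | yes _  | no l≰n = contradiction l≤n l≰n
  ... | yes p  | yes q  = Fin.fromℕ<-injective _ _ (ℕ.s≤s p) (ℕ.s≤s q) eq

  ℕ-injection⇒⊥ : ∀ n (h : ℕ → Fin n) → ¬ Injective _≡_ _≡_ h
  ℕ-injection⇒⊥ n h inj = ℕ.<-irrefl refl (injective⇒≤ {f = h ∘ Fin.toℕ} (Fin.toℕ-injective ∘ inj))

  -- Adding ω makes the square theorem true for finite ξ as well, and makes
  -- room for μ itself when {x ≤ μ} is mapped into ω+ μ.

  module _ {ℓ} (O : Ordinal ℓ) where

    ω+ : ⟨ O ⟩ → Ordinal ℓ
    ω+ ξ = record
      { Carrier            = ℕ ⊎ ⟨ O ↓ ξ ⟩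
      ; _<_                = ℕ._<_ ⊎-< Ordinal._<_ (O ↓ ξ)
      ; isStrictTotalOrder = record
        { isStrictPartialOrder = record
          { isEquivalence = isEquivalence
          ; irrefl        = λ { refl lt → ⊎-<-asymmetric ℕ.<-asym (λ {x} {y} → asym x y) lt lt }
          ; trans         = ⊎-<-transitive ℕ.<-trans (λ {x} {y} {z} → Ordinal.trans (O ↓ ξ) {x} {y} {z})
          ; <-resp-≈      = resp₂ _
          }
        ; compare = λ x y → fromPointwise (⊎-<-trichotomous ℕ.<-cmp (Ordinal.compare (O ↓ ξ)) x y)
        }
      ; wellFounded        = ⊎-<-wellFounded ℕ.<-wellFounded (Ordinal.wellFounded (O ↓ ξ))
      }
      where
      asym : ∀ (x y : ⟨ O ↓ ξ ⟩) → Ordinal._<_ (O ↓ ξ) x y → ¬ Ordinal._<_ (O ↓ ξ) y x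
      asym _ _ lt gt = Ordinal.irrefl O refl (Ordinal.trans O lt gt)
      fromPointwise : ∀ {A B : Set ℓ} {x y : ℕ ⊎ ⟨ O ↓ ξ ⟩} →
                      Tri A (Pointwise _≡_ _≡_ x y) B → Tri A (x ≡ y) B
      fromPointwise (tri< a ¬b ¬c) = tri< a (¬b ∘ ≡⇒Pointwise-≡) ¬c
      fromPointwise (tri≈ ¬a b ¬c) = tri≈ ¬a (Pointwise-≡⇒≡ b) ¬c
      fromPointwise (tri> ¬a ¬b c) = tri> ¬a (¬b ∘ ≡⇒Pointwise-≡) c

    open Ordinal O

    shrink : ∀ {ξ} μ → ⟨ ω+ ξ ⟩ → ⟨ ω+ μ ⟩
    shrink μ (inj₁ k) = inj₁ (ℕ.suc k)
    shrink μ (inj₂ x) with em {P = value x < μ}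
    ... | yes x<μ = inj₂ (value x , [ x<μ ])
    ... | no _    = inj₁ 0

    open Order using (_≤_)

    shrink-injective : ∀ {ξ} (μ : ⟨ O ↓ ξ ⟩) {x y} → _≤_ (ω+ ξ) x (inj₂ μ) → _≤_ (ω+ ξ) y (inj₂ μ) →
                       shrink (value μ) x ≡ shrink (value μ) y → x ≡ y
    shrink-injective μ {inj₁ k} {inj₁ l} _ _ eq = cong inj₁ (ℕ.suc-injective (inj₁-injective eq))
    shrink-injective μ {inj₁ k} {inj₂ y} _ _ eq with em {P = value y < value μ} | eq
    ... | yes _ | ()
    ... | no _  | ()
    shrink-injective μ {inj₂ x} {inj₁ l} _ _ eq with em {P = value x < value μ} | eq
    ... | yes _ | ()
    ... | no _  | ()
    shrink-injective μ {inj₂ x} {inj₂ y} x≤μ y≤μ eq with em {P = value x < value μ} | em {P = value y < value μ} | eq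
    ... | yes _  | yes _ | eq = cong inj₂ (value-injective (cong value (inj₂-injective eq)))
    ... | no x≮μ | no y≮μ | _  = ≡-trans (top x≤μ x≮μ) (sym (top y≤μ y≮μ))
      where
      top : ∀ {x} → _≤_ (ω+ _) (inj₂ x) (inj₂ μ) → ¬ (value x < value μ) → inj₂ x ≡ inj₂ μ
      top (inj₁ (₂∼₂ x<μ)) x≮μ = contradiction x<μ x≮μ
      top (inj₂ eq)        _   = eq

    abstract

      -- Induction on ξ. If `ω+ ξ` embeds into a smaller `ω+ μ`, the injection is inherited from
      -- there. Otherwise no square of a closed initial segment can receive `ω+ ξ`: below a point μ
      -- by the induction hypothesis, below a natural number by the pigeonhole principle.
      ω+-square : ∀ ξ → (⟨ ω+ ξ ⟩ × ⟨ ω+ ξ ⟩) ↣ ⟨ ω+ ξ ⟩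
      ω+-square = All.wfRec wellFounded _ _ step
        where
        include : ∀ {μ ξ} → μ < ξ → ⟨ ω+ μ ⟩ ↣ ⟨ ω+ ξ ⟩
        include {μ} {ξ} μ<ξ = mk↣ {to = f} inj
          where
          f : ⟨ ω+ μ ⟩ → ⟨ ω+ ξ ⟩
          f (inj₁ k) = inj₁ k
          f (inj₂ x) = inj₂ (value x , [ trans (holds x) μ<ξ ])
          inj : ∀ {x y} → f x ≡ f y → x ≡ y
          inj {inj₁ _} {inj₁ _} eq = cong inj₁ (inj₁-injective eq)
          inj {inj₂ _} {inj₂ _} eq = cong inj₂ (value-injective (cong value (inj₂-injective eq)))
        step : ∀ ξ → (∀ {μ} → μ < ξ → (⟨ ω+ μ ⟩ × ⟨ ω+ μ ⟩) ↣ ⟨ ω+ μ ⟩) → (⟨ ω+ ξ ⟩ × ⟨ ω+ ξ ⟩) ↣ ⟨ ω+ ξ ⟩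
        step ξ ih with em {P = ∃[ μ ] μ < ξ × (⟨ ω+ ξ ⟩ ↣ ⟨ ω+ μ ⟩)}
        ... | yes (μ , μ<ξ , j) = include μ<ξ ↣-∘ (ih μ<ξ ↣-∘ (j ×-↣ j))
        ... | no small = square↣ (ω+ ξ) (inj₁ 0) noSegment
          where
          noSegment : ∀ m (h : ⟨ ω+ ξ ⟩ → ⟨ ω+ ξ ⟩ × ⟨ ω+ ξ ⟩) → Injective _≡_ _≡_ h →
                      ¬ (∀ x → _≤_ (ω+ ξ) (proj₁ (h x)) m × _≤_ (ω+ ξ) (proj₂ (h x)) m)
          noSegment (inj₂ μ) h inj bound = small (value μ , holds μ , (ih (holds μ) ↣-∘ mk↣
            {to = λ x → shrink (value μ) (proj₁ (h x)) , shrink (value μ) (proj₂ (h x))}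
            λ {x} {y} eq → inj (cong₂ _,_
              (shrink-injective μ (proj₁ (bound x)) (proj₁ (bound y)) (,-injectiveˡ eq))
              (shrink-injective μ (proj₂ (bound x)) (proj₂ (bound y)) (,-injectiveʳ eq)))))
          noSegment (inj₁ n) h inj bound = ℕ-injection⇒⊥ _ code code-injective
            where
            left : ⟨ ω+ ξ ⟩ → ℕ
            left (inj₁ k) = k
            left (inj₂ _) = 0
            left≤ : ∀ {x} → _≤_ (ω+ ξ) x (inj₁ n) → left x ℕ.≤ n × x ≡ inj₁ (left x)
            left≤ {inj₁ k} (inj₁ (₁∼₁ k<n)) = ℕ.<⇒≤ k<n , refl
            left≤ {inj₁ k} (inj₂ refl)      = ℕ.≤-refl , refl
            left-injective : ∀ {x y} → _≤_ (ω+ ξ) x (inj₁ n) → _≤_ (ω+ ξ) y (inj₁ n) →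
                             clamp n (left x) ≡ clamp n (left y) → x ≡ y
            left-injective x≤n y≤n eq =
              let (x≤ , x≡) = left≤ x≤n ; (y≤ , y≡) = left≤ y≤n in
              ≡-trans x≡
                (≡-trans (cong inj₁ (clamp-injective n x≤ y≤ eq)) (sym y≡))
            code : ℕ → Fin (ℕ.suc n ℕ.* ℕ.suc n)
            code k = let (x , y) = h (inj₁ k) in Fin.combine (clamp n (left x)) (clamp n (left y))
            code-injective : Injective _≡_ _≡_ code
            code-injective {k} {l} eq =
              let (eq₁ , eq₂) = combine-injective _ _ _ _ eq
                  (x≤ , y≤)   = bound (inj₁ k)
                  (x′≤ , y′≤) = bound (inj₁ l)
              in inj₁-injective (inj (cong₂ _,_ (left-injective x≤ x′≤ eq₁) (left-injective y≤ y′≤ eq₂)))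

  abstract

    -- The n-th newcomer goes to place 2n+1 of the copy of ℕ in `A`, whose n-th element moves to
    -- place 2n; all else stays.
    hilbertHotel : ∀ {a} {A : Set a} → ℕ ↣ A → (ℕ ⊎ A) ↣ A
    hilbertHotel {A = A} h = mk↣ {to = f} inj
      where
      move : ∀ x → Dec (∃[ n ] to h n ≡ x) → A
      move x (yes (n , _)) = to h (n ℕ.+ n)
      move x (no _)        = x
      f : ℕ ⊎ A → A
      f (inj₁ n) = to h (ℕ.suc (n ℕ.+ n))
      f (inj₂ x) = move x em
      odd≢even : ∀ m n → ℕ.suc (m ℕ.+ m) ≢ n ℕ.+ n
      odd≢even ℕ.zero    (ℕ.suc n) eq = contradiction (≡-trans (ℕ.suc-injective eq) (ℕ.+-suc n n)) λ ()
      odd≢even (ℕ.suc m) (ℕ.suc n) eq = odd≢even m n (ℕ.suc-injective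
        (≡-trans (cong ℕ.suc (sym (ℕ.+-suc m m))) (≡-trans (ℕ.suc-injective eq) (ℕ.+-suc n n))))
      double-injective : ∀ {m n} → m ℕ.+ m ≡ n ℕ.+ n → m ≡ n
      double-injective {ℕ.zero}  {ℕ.zero}  _  = refl
      double-injective {ℕ.suc m} {ℕ.suc n} eq = cong ℕ.suc (double-injective (ℕ.suc-injective
        (≡-trans (sym (ℕ.+-suc m m)) (≡-trans (ℕ.suc-injective eq) (ℕ.+-suc n n)))))
      odd≢move : ∀ n x d → to h (ℕ.suc (n ℕ.+ n)) ≢ move x d
      odd≢move n x (yes (m , _)) eq = odd≢even n m (injective h eq)
      odd≢move n x (no ¬h)       eq = ¬h (_ , eq)
      move-injective : ∀ {x y} d d′ → move x d ≡ move y d′ → x ≡ y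
      move-injective (yes (m , hm≡x)) (yes (n , hn≡y)) eq =
        ≡-trans (sym hm≡x) (≡-trans (cong (to h) (double-injective (injective h eq))) hn≡y)
      move-injective (yes _)  (no ¬h) eq = contradiction (_ , eq) ¬h
      move-injective (no ¬h) (yes _)  eq = contradiction (_ , sym eq) ¬h
      move-injective (no _)  (no _)   eq = eq
      inj : ∀ {x y} → f x ≡ f y → x ≡ y
      inj {inj₁ m} {inj₁ n} eq = cong inj₁ (double-injective (ℕ.suc-injective (injective h eq)))
      inj {inj₁ m} {inj₂ y} eq = contradiction eq (odd≢move m y em)
      inj {inj₂ x} {inj₁ n} eq = contradiction (sym eq) (odd≢move n x em)
      inj {inj₂ x} {inj₂ y} eq = cong inj₂ (move-injective em em eq)

  -- Lexicographically descending sequences.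

  module _ {ℓ} (O : Ordinal ℓ) where
    open Order O

    abstract

      -- |i|⁺ is regular.

      bounded : ∀ {i μ} → ℕ ↣ ⟨ O ↓ i ⟩ → ¬ (⟨ O ↓ μ ⟩ ↣ ⟨ O ↓ i ⟩) →
                (∀ ν → ν < μ → ⟨ O ↓ ν ⟩ ↣ ⟨ O ↓ i ⟩) →
                ∀ (h : ⟨ O ↓ i ⟩ → ⟨ O ⟩) → (∀ k → h k < μ) → ∃[ s ] s < μ × (∀ k → h k < s)
      bounded {i} {μ} ℕ↣i ¬μ↣i ν↣i h h<μ = byContradiction λ unbounded →
        -- If `h` were unbounded, each s < μ would satisfy s ≤ h k for some k. The pair of k and the
        -- place of s in h k, which injects into i, would then inject μ into |i| · |i| = |i|.
        let above : ∀ (s : ⟨ O ↓ μ ⟩) → ∃[ k ] value s ≤ h k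
            above s = byContradiction λ none →
              unbounded (value s , holds s , λ k → byContradiction λ ≮ → none (k , ≮⇒≥ ≮))
        in ¬μ↣i (hilbertHotel ℕ↣i ↣-∘ (ω+-square O i ↣-∘ mk↣
             {to = λ s → inj₂ (proj₁ (above s)) , code (proj₁ (above s)) (value s)}
             λ {s} {t} eq → value-injective (code-injective (inj₂-injective (,-injectiveˡ eq))
               (proj₂ (above s)) (proj₂ (above t)) (,-injectiveʳ eq))))
        where
        code : ⟨ O ↓ i ⟩ → ⟨ O ⟩ → ⟨ ω+ O i ⟩
        code k s with em {P = s < h k}
        ... | yes s<hk = inj₂ (to (ν↣i (h k) (h<μ k)) (s , [ s<hk ]))
        -- This value stands for s = h k, the top of the segment on which `code` is used.
        ... | no _     = inj₁ 0
        code-injective : ∀ {k l s t} → k ≡ l → s ≤ h k → t ≤ h l → code k s ≡ code l t → s ≡ t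
        code-injective {k} {_} {s} {t} refl s≤ t≤ eq with em {P = s < h k} | em {P = t < h k} | eq
        ... | yes _ | yes _ | eq = cong value (injective (ν↣i (h k) (h<μ k)) (inj₂-injective eq))
        ... | no s≮ | no t≮ | _  = ≡-trans (top s≤ s≮) (sym (top t≤ t≮))
          where
          top : ∀ {s} → s ≤ h k → ¬ (s < h k) → s ≡ h k
          top (inj₁ lt) ≮ = contradiction lt ≮
          top (inj₂ eq) _ = eq

  module _ {ℓ} (I O : Ordinal ℓ) where
    private
      module I = Order I
      module O = Order O

    -- The lexicographic ordering read downwards: j is the first difference, and v lies below u.
    Descends : (u v : ⟨ I ⟩ → ⟨ O ⟩) → Set ℓ
    Descends u v = ∃[ j ] (∀ k → k I.< j → u k ≡ v k) × v j O.< u j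

    -- Every coordinate of a lexicographically descending sequence is
    -- eventually constant; the bounds exist because M is longer than I.

    module _ (M : Ordinal ℓ) where
      private
        module M = Order M

      noLexDescending : ⟨ M ⟩ → ⟨ I ⟩ → (∀ (h : ⟨ I ⟩ → ⟨ M ⟩) → ∃[ s ] ∀ k → h k M.< s) →
                        (W : ⟨ M ⟩ → ⟨ I ⟩ → ⟨ O ⟩) →
                        ¬ (∀ s t → s M.< t → Descends (W s) (W t))
      noLexDescending o k₀ bound W desc =
        -- From s on every coordinate is constant, so `W s` and `W t` cannot differ; bounding the
        -- constant function s supplies the later index t.
        let (s , above) = bound (λ k → proj₁ (stable k))
            (t , s<t)   = bound (λ _ → s)
            (l , _ , lower) = desc s t (s<t k₀)
            eq = proj₂ (stable l)
        in O.irrefl (≡-trans (eq t (inj₁ (M.trans (above l) (s<t k₀)))) (sym (eq s (inj₁ (above l))))) lower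
        where
        StableFrom : ⟨ I ⟩ → ⟨ M ⟩ → Set ℓ
        StableFrom j s = ∀ t → s M.≤ t → W t j ≡ W s j
        Value : ⟨ I ⟩ → ⟨ M ⟩ → Pred ⟨ O ⟩ ℓ
        Value j s v = ∃[ t ] s M.≤ t × W t j ≡ v
        -- The least value taken at `j` from s₀ on is taken at s₁. A later change at `j` would be a
        -- first difference at `j`, against minimality, or come with one before `j`, against
        -- stability there.
        stableAfter : ∀ j s → (∀ k → k I.< j → StableFrom k s) →
                      ∃[ v ] Value j s v × (∀ u → u O.< v → ¬ Value j s u) → ∃[ s ] StableFrom j s
        stableAfter j s₀ stable₀ (_ , (s₁ , s₀≤s₁ , refl) , minimal) = s₁ , stable₁
          where
          stable₁ : StableFrom j s₁
          stable₁ t (inj₂ refl) = refl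
          stable₁ t (inj₁ s₁<t) with desc s₁ t s₁<t
          ... | l , agree , lower with I.compare l j
          ...   | tri< l<j _ _  = contradiction lower
            (O.irrefl (≡-trans (stable₀ l l<j t (M.≤-trans s₀≤s₁ (inj₁ s₁<t))) (sym (stable₀ l l<j s₁ s₀≤s₁))))
          ...   | tri≈ _ refl _ = contradiction (t , M.≤-trans s₀≤s₁ (inj₁ s₁<t) , refl) (minimal _ lower)
          ...   | tri> _ _ j<l  = sym (agree j j<l)
        stable : ∀ j → ∃[ s ] StableFrom j s
        stable = All.wfRec I.wellFounded _ _ step
          where
          step : ∀ j → (∀ {k} → k I.< j → ∃[ s ] StableFrom k s) → ∃[ s ] StableFrom j s
          step j ih =
            let (s₀ , above) = bound (λ k → pick k em) in
            stableAfter j s₀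
              (λ k k<j t s₀≤t → let eq = pick-stable k em k<j in
                ≡-trans (eq t (inj₁ (M.<-≤-trans (above k) s₀≤t))) (sym (eq s₀ (inj₁ (above k)))))
              (least O.wellFounded (_ , s₀ , inj₂ refl , refl))
            where
            pick : ∀ k → Dec (k I.< j) → ⟨ M ⟩
            pick k (yes k<j) = proj₁ (ih k<j)
            -- A dummy for coordinates not below `j`, since `bound` expects a function on all of
            -- `I`.
            pick k (no _)    = o
            pick-stable : ∀ k d → k I.< j → StableFrom k (pick k d)
            pick-stable k (yes k<j) _   = proj₂ (ih k<j)
            pick-stable k (no k≮j)  k<j = contradiction k<j k≮j

  module _ {ℓ} (O : Ordinal ℓ) where
    open Order O

    -- As θ may be singular, the sequence is cut down to length μ ≤ θ, the least ordinal not
    -- injecting into i. This is |i|⁺, in which families indexed by i are bounded, as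
    -- `noLexDescending` requires.
    θ-descending : ∀ {i θ} → i < θ → IsCardinal (O ↓ θ) → ℕ ↣ ⟨ O ↓ i ⟩ →
                   (V : ⟨ O ↓ θ ⟩ → ⟨ O ↓ i ⟩ → ⟨ O ⟩) →
                   ¬ (∀ s t → value s < value t → Descends (O ↓ i) O (V s) (V t))
    θ-descending {i} {θ} i<θ θ-card ℕ↣i V desc =
      let (μ , μ↣̸i , below) = least wellFounded {P = λ μ → ¬ (⟨ O ↓ μ ⟩ ↣ ⟨ O ↓ i ⟩)} (θ , θ↣̸i)
          μ≤θ = ≮⇒≥ λ θ<μ → below θ θ<μ θ↣̸i
          ν↣i = λ ν ν<μ → byContradiction (below ν ν<μ)
          W : ⟨ O ↓ μ ⟩ → ⟨ O ↓ i ⟩ → ⟨ O ⟩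
          W = λ s → V (value s , [ <-≤-trans (holds s) μ≤θ ])
          o = byContradiction {P = ⟨ O ↓ μ ⟩} λ empty → μ↣̸i
                (mk↣ {to = λ s → contradiction s empty} λ {s} _ → contradiction s empty)
      in noLexDescending (O ↓ i) O (O ↓ μ) o (to ℕ↣i 0)
           (λ h → let (s , s<μ , above) = bounded O ℕ↣i μ↣̸i ν↣i (value ∘ h) (holds ∘ h) in
                  (s , [ s<μ ]) , above)
           W (λ s t s<t → desc _ _ s<t)
      where
      θ↣̸i : ¬ (⟨ O ↓ θ ⟩ ↣ ⟨ O ↓ i ⟩)
      θ↣̸i f = θ-card (i , [ i<θ ]) (mk↣ {to = λ k → (value k , [ trans (holds k) i<θ ]) , [ holds k ]}
                (λ eq → value-injective (cong (value ∘ value) eq)) ↣-∘ f)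

  -- Splitting points, from the partition relation.

  enumerate : ∀ {a b r} {A : Set a} (_R_ : Rel A r) {B : 𝒫 A} (α : Ordinal b) → HasOrderType _R_ B α →
              ∃[ z ] (∀ ξ → z ξ ∈ B) × (∀ ξ η → Ordinal._<_ α ξ η → z ξ R z η)
  enumerate _R_ {B} α (f , iso) = value ∘ pre , (λ ξ → holds (pre ξ)) ,
      λ ξ η ξ<η → cancel (subst₂ (Ordinal._<_ α) (sym (f-pre ξ)) (sym (f-pre η)) ξ<η)
    where
    open IsOrderIsomorphism iso
    pre : ⟨ α ⟩ → El B
    pre ξ = proj₁ (surjective ξ)
    f-pre : ∀ ξ → f (pre ξ) ≡ ξ
    f-pre ξ = proj₂ (surjective ξ) refl

  -- Sierpiński's colouring of the pairs at which the lexicographic ordering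
  -- disagrees with that of κ.  Along a set of type κ on which the two agree,
  -- consecutive branches split at pairwise different places.

  module _ {ℓ} (O : Ordinal ℓ) (κ θ : ⟨ O ⟩) where
    open Order O

    splittingPoints : ∀ {i} → i < θ → IsCardinal (O ↓ θ) → ℕ ↣ ⟨ O ↓ i ⟩ →
      (O ↓ κ) ⟶⟨κ, O ↓ θ ⟩² →
      (∀ (γ : ⟨ O ↓ κ ⟩) → ∃[ δ ] Ordinal._<_ (O ↓ κ) γ δ) →
      (V : ⟨ O ↓ κ ⟩ → ⟨ O ↓ i ⟩ → ⟨ O ⟩) → (∀ α β → α ≢ β → ∃[ j ] V α j ≢ V β j) →
      Σ[ z ∈ (⟨ O ↓ κ ⟩ → ⟨ O ↓ κ ⟩) ] Σ[ j ∈ (⟨ O ↓ κ ⟩ → ⟨ O ↓ i ⟩) ]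
        (∀ γ γ′ → j γ ≡ j γ′ → (∀ k → value k ≤ value (j γ) → V (z γ) k ≡ V (z γ′) k) → γ ≡ γ′)
    splittingPoints {i} i<θ θ-card ℕ↣i partition unbounded V distinct = byColour (partition colour)
      where
      module K = Order (O ↓ κ)
      module I = Order (O ↓ i)
      colour : Refinement (⟨ O ↓ κ ⟩ × ⟨ O ↓ κ ⟩) (λ (α , β) → α K.< β) → Bool
      colour ((α , β) , _) = ⌊ em {P = Descends (O ↓ i) O (V α) (V β)} ⌋
      Splits : ⟨ O ↓ κ ⟩ → ⟨ O ↓ κ ⟩ → ⟨ O ↓ i ⟩ → Set ℓ
      Splits α β j = V α j ≢ V β j × (∀ k → k I.< j → V α k ≡ V β k)
      split : ∀ α β → α ≢ β → ∃[ j ] Splits α β j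
      split α β α≢β =
        let (j , ≢ , before) = least I.wellFounded (distinct α β α≢β)
        in j , ≢ , λ k k<j → byContradiction (before k k<j)

      module _ {A : 𝒫 ⟨ O ↓ κ ⟩} (type-κ : HasOrderType K._<_ A (O ↓ κ))
               (false-on-A : Constantly colour false (IncreasingPairs (O ↓ κ) A)) where
        z : ⟨ O ↓ κ ⟩ → ⟨ O ↓ κ ⟩
        z = proj₁ (enumerate K._<_ (O ↓ κ) type-κ)
        z∈A : ∀ γ → z γ ∈ A
        z∈A = proj₁ (proj₂ (enumerate K._<_ (O ↓ κ) type-κ))
        z-mono : ∀ γ δ → γ K.< δ → z γ K.< z δ
        z-mono = proj₂ (proj₂ (enumerate K._<_ (O ↓ κ) type-κ))
        ascending : ∀ γ δ → γ K.< δ → ¬ Descends (O ↓ i) O (V (z γ)) (V (z δ))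
        ascending γ δ γ<δ d = subst T (false-on-A ((z γ , z δ) , [ z-mono γ δ γ<δ ])
          (z∈A γ , z∈A δ , z-mono γ δ γ<δ))
          (fromWitness {a? = em} d)
        next : ∀ γ → ∃[ δ ] γ K.< δ × (∀ ε → ε K.< δ → ¬ (γ K.< ε))
        next γ = least K.wellFounded (unbounded γ)
        splitNext : ∀ γ → ∃[ j ] Splits (z γ) (z (proj₁ (next γ))) j
        splitNext γ = split (z γ) (z (proj₁ (next γ))) λ eq →
          K.irrefl eq (z-mono _ _ (proj₁ (proj₂ (next γ))))
        -- At `j` the sequence of γ lies below that of δ, the opposite being a descent. If γ′ agreed
        -- with γ up to `j`, its sequence would lie below that of δ too, a descent from δ to γ′; for
        -- δ = γ′ the agreement contradicts the split outright.
        noCollision : ∀ γ γ′ δ j → γ K.< δ → δ K.≤ γ′ → Splits (z γ) (z δ) j →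
                      ¬ (∀ k → k I.≤ j → V (z γ) k ≡ V (z γ′) k)
        noCollision γ γ′ δ j γ<δ (inj₂ refl) (≢ , _) agree = ≢ (agree j (inj₂ refl))
        noCollision γ γ′ δ j γ<δ (inj₁ δ<γ′) (≢ , before) agree with ≢⇒<⊎> (V (z γ) j) (V (z δ) j) ≢
        ... | inj₂ gt = ascending γ δ γ<δ (j , before , gt)
        ... | inj₁ lt = ascending δ γ′ δ<γ′
                (j , (λ k k<j → ≡-trans (sym (before k k<j)) (agree k (inj₁ k<j))) ,
                 subst (_< V (z δ) j) (agree j (inj₂ refl)) lt)
        collision : ∀ γ γ′ → γ K.< γ′ → ¬ (∀ k → k I.≤ proj₁ (splitNext γ) → V (z γ) k ≡ V (z γ′) k)
        collision γ γ′ γ<γ′ = noCollision γ γ′ (proj₁ (next γ)) _ (proj₁ (proj₂ (next γ)))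
          (K.≮⇒≥ λ lt → proj₂ (proj₂ (next γ)) γ′ lt γ<γ′) (proj₂ (splitNext γ))
        ≤-lift : ∀ {k j} → k I.≤ j → value k ≤ value j
        ≤-lift (inj₁ lt)   = inj₁ lt
        ≤-lift (inj₂ refl) = inj₂ refl
        unique : ∀ γ γ′ → proj₁ (splitNext γ) ≡ proj₁ (splitNext γ′) →
                 (∀ k → value k ≤ value (proj₁ (splitNext γ)) → V (z γ) k ≡ V (z γ′) k) → γ ≡ γ′
        unique γ γ′ eq agree with K.compare γ γ′
        ... | tri< γ<γ′ _ _ = contradiction (λ k k≤ → agree k (≤-lift k≤)) (collision γ γ′ γ<γ′)
        ... | tri≈ _ γ≡γ′ _ = γ≡γ′
        ... | tri> _ _ γ′<γ = contradiction (λ k k≤ → sym (agree k (≤-lift (subst (k I.≤_) (sym eq) k≤))))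
                                (collision γ′ γ γ′<γ)

      byColour : ∃[ A ] ((HasOrderType K._<_ A (O ↓ κ) × Constantly colour false (IncreasingPairs (O ↓ κ) A))
                       ⊎ (HasOrderType K._<_ A (O ↓ θ) × Constantly colour true  (IncreasingPairs (O ↓ κ) A))) →
        Σ[ z ∈ (⟨ O ↓ κ ⟩ → ⟨ O ↓ κ ⟩) ] Σ[ j ∈ (⟨ O ↓ κ ⟩ → ⟨ O ↓ i ⟩) ]
          (∀ γ γ′ → j γ ≡ j γ′ → (∀ k → value k ≤ value (j γ) → V (z γ) k ≡ V (z γ′) k) → γ ≡ γ′)
      byColour (A , inj₂ (type-θ , true-on-A)) =
        -- Colour 1 on a set of type θ is a lexicographically descending θ-sequence.
        let (z , z∈A , increasing) = enumerate K._<_ (O ↓ θ) type-θ in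
        contradiction (λ s t s<t → toWitness {a? = em} (subst T
              (sym (true-on-A ((z s , z t) , [ increasing s t s<t ]) (z∈A s , z∈A t , increasing s t s<t))) _))
          (θ-descending O i<θ θ-card ℕ↣i (V ∘ z))
      byColour (A , inj₁ (type-κ , false-on-A)) =
        z type-κ false-on-A , (λ γ → proj₁ (splitNext type-κ false-on-A γ)) , unique type-κ false-on-A

  -- Regular cardinals and generic points of the space.

  T-injective : ∀ {x y} → (T x → T y) → (T y → T x) → x ≡ y
  T-injective {false} {false} _ _ = refl
  T-injective {false} {true}  _ g = ⊥-elim (g tt)
  T-injective {true}  {false} f _ = ⊥-elim (f tt)
  T-injective {true}  {true}  _ _ = refl

  ¬T⇒false : ∀ {x} → ¬ T x → x ≡ false
  ¬T⇒false ¬t = T-injective (λ t → ⊥-elim (¬t t)) ⊥-elim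

  module Regular {ℓ} (K : Ordinal ℓ) (cardinal : IsCardinal K) (ℕ↣K : ℕ ↣ ⟨ K ⟩) (regular : IsRegular K) where
    private
      module K = Order K

    -- The contrapositive of regularity: a subset that κ does not inject into is not cofinal.
    bounded-subset : (a : 𝒫 ⟨ K ⟩) → ¬ (⟨ K ⟩ ↣ El a) → ∃[ δ ] (∀ ξ → ξ ∈ a → ξ K.< δ)
    bounded-subset a small =
      let (δ , bound) = counterexample (small ∘ regular a)
      in δ , λ ξ ξ∈a → byContradiction λ ξ≮δ → bound (ξ , ξ∈a , K.≮⇒≥ ξ≮δ)

    subsingleton : ∀ {a} {A : Set a} → (∀ (x y : A) → x ≡ y) → A ⟪ ⟨ K ⟩
    subsingleton eq = mk↣ {to = λ _ → to ℕ↣K 0} (λ _ → eq _ _) ,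
      λ f → contradiction (injective ℕ↣K (injective f (eq (to f (to ℕ↣K 0)) (to f (to ℕ↣K 1))))) λ ()

    singleton : ∀ {a} {A : Set a} → A → 𝒫 A
    singleton x = set (_≡ x)

    singleton-subsingleton : ∀ {a} {A : Set a} {x : A} (y z : El (singleton x)) → y ≡ z
    singleton-subsingleton y z = value-injective (≡-trans (∈-set⁻ (holds y)) (sym (∈-set⁻ (holds z))))

    abstract

      unbounded : ∀ γ → ∃[ δ ] γ K.< δ
      unbounded γ =
        let (δ , bound) = bounded-subset (singleton γ) (proj₂ (subsingleton singleton-subsingleton))
        in δ , bound γ (∈-set⁺ {P = _≡ γ} {x = γ} refl)

    initial : ⟨ K ⟩ → 𝒫< ⟨ K ⟩ ⟨ K ⟩
    initial δ = set (K._< δ) ,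
      [ mk↣ {to = value} value-injective , (λ f → cardinal δ
          (mk↣ {to = λ x → value x , [ ∈-set⁻ (holds x) ]} (λ eq → value-injective (cong value eq)) ↣-∘ f)) ]

    -- The sets D c being dense open, their complements form a family of fewer
    -- than cov(M) meagre sets, which cannot cover the space.

    generic : ∀ {covM : Set ℓ} {I : Set ℓ} → IsCovM K covM → ¬ (covM ↣ I) →
              (D : I → 𝒫 (Space K)) → (∀ c → IsOpen K (D c)) → (∀ c → IsDense K (D c)) →
              ∃[ f ] (∀ c → f ∈ D c)
    generic {I = I} (_ , least) covM↣̸I D open′ dense = byContradiction λ none →
      let cover : ∀ f → ∃[ W ] W ∈ Y × f ∈ W
          cover f =
            let (c , f∉Dc) = counterexample (λ all → none (f , all))
            in complement c , ∈-set⁺ (c , refl) , ∈-complement c f f∉Dc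
      in covM↣̸I (Y↣I ↣-∘ least Y (meagre , cover))
      where
      complement : I → 𝒫 (Space K)
      complement c f = not (D c f)
      ∈-complement : ∀ c f → ¬ (f ∈ D c) → f ∈ complement c
      ∈-complement c f f∉ with D c f
      ... | false = tt
      ... | true  = f∉ tt
      complement-∌ : ∀ c f → f ∈ complement c → ¬ (f ∈ D c)
      complement-∌ c f with D c f
      ... | false = λ _ ()
      ... | true  = λ ()
      Y : 𝒫 (𝒫 (Space K))
      Y = set (λ W → ∃[ c ] W ≡ complement c)
      Y↣I : El Y ↣ I
      Y↣I = mk↣ {to = λ W → proj₁ (∈-set⁻ (holds W))} λ {W} {W′} eq → value-injective
        (≡-trans (proj₂ (∈-set⁻ (holds W))) (≡-trans (cong complement eq) (sym (proj₂ (∈-set⁻ (holds W′))))))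
      meagre : ∀ W → W ∈ Y → IsMeagre K W
      meagre W W∈Y with ∈-set⁻ W∈Y
      -- A family with the single member `D c` witnesses meagreness.
      ... | c , refl = singleton (D c) , (D c , ∈-set⁺ refl) , proj₁ (subsingleton singleton-subsingleton) ,
        (λ E E∈ → subst (λ E → IsOpen K E × IsDense K E) (sym (∈-set⁻ E∈)) (open′ c , dense c)) ,
        λ f f∈W all → complement-∌ c f f∈W (all (D c) (∈-set⁺ refl))

  -- Traces and null sets.

  module Traces {ℓ} (Λ : Ordinal ℓ) (κ : ⟨ Λ ⟩) (cardinal : IsCardinal (Λ ↓ κ))
                (ℕ↣κ : ℕ ↣ ⟨ Λ ↓ κ ⟩) (regular : IsRegular (Λ ↓ κ)) where
    open Order Λ
    open Regular (Λ ↓ κ) cardinal ℕ↣κ regular public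

    κ-unbounded : ∀ γ → γ < κ → ∃[ δ ] δ < κ × γ < δ
    κ-unbounded γ γ<κ = let (δ , γ<δ) = unbounded (γ , [ γ<κ ]) in value δ , holds δ , γ<δ

    S : Set ℓ
    S = Pκλ Λ κ

    abstract

      -- Having fewer than κ elements, b ∩ κ is bounded below κ by regularity; its least upper bound
      -- exists by well-foundedness.
      trace : ∀ (b : S) → Σ[ ξ ∈ ⟨ Λ ⟩ ] ξ < κ × IsTrace Λ κ b ξ
      trace b = proj₁ sup , ≤-<-trans (≮⇒≥ λ δ<ξ → proj₂ (proj₂ sup) (value δ) δ<ξ δ-bounds) (holds δ) , λ η → mk⇔
          (λ η<ξ → byContradiction λ none → proj₂ (proj₂ sup) η η<ξ
             λ x x∈b x<κ → ≮⇒≥ λ η<x → none (x , (x∈b , x<κ) , η<x))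
          (λ (x , (x∈b , x<κ) , η<x) → <-≤-trans η<x (proj₁ (proj₂ sup) x x∈b x<κ))
        where
        b∩κ : 𝒫 ⟨ Λ ↓ κ ⟩
        b∩κ ξ = value b (value ξ)
        bound : Σ[ δ ∈ ⟨ Λ ↓ κ ⟩ ] (∀ (ξ : ⟨ Λ ↓ κ ⟩) → ξ ∈ b∩κ → value ξ < value δ)
        bound = bounded-subset b∩κ λ f → proj₂ (holds b)
          (mk↣ {to = λ x → value (value x) , [ holds x ]}
             (λ eq → value-injective (value-injective (cong value eq))) ↣-∘ f)
        δ : ⟨ Λ ↓ κ ⟩
        δ = proj₁ bound
        Bounds : Pred ⟨ Λ ⟩ ℓ
        Bounds ξ = ∀ x → x ∈ value b → x < κ → x ≤ ξ
        δ-bounds : Bounds (value δ)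
        δ-bounds x x∈b x<κ = inj₁ (proj₂ bound (x , [ x<κ ]) x∈b)
        sup : ∃[ ξ ] Bounds ξ × (∀ η → η < ξ → ¬ Bounds η)
        sup = least wellFounded (value δ , δ-bounds)

    τ : S → ⟨ Λ ⟩
    τ b = proj₁ (trace b)

    τ<κ : ∀ b → τ b < κ
    τ<κ b = proj₁ (proj₂ (trace b))

    τ-isTrace : ∀ b → IsTrace Λ κ b (τ b)
    τ-isTrace b = proj₂ (proj₂ (trace b))

    trace-unique : ∀ {b ξ} → IsTrace Λ κ b ξ → ξ ≡ τ b
    trace-unique {b} {ξ} ξ-trace with compare ξ (τ b)
    ... | tri< lt _ _ = contradiction (Equivalence.from (ξ-trace ξ) (Equivalence.to (τ-isTrace b ξ) lt)) (irrefl refl)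
    ... | tri≈ _ eq _ = eq
    ... | tri> _ _ gt =
      contradiction (Equivalence.from (τ-isTrace b (τ b)) (Equivalence.to (ξ-trace (τ b)) gt)) (irrefl refl)

    module IdealOn {H : 𝒫 (𝒫 S)} (ideal : IsIdealOnPκλ Λ κ H) where
      open IsIdealOnPκλ ideal
      open IsIdeal isIdeal

      Null : ∀ {p} → Pred S p → Set
      Null P = set P ∈ H

      null-⊆ : ∀ {p q} {P : Pred S p} {Q : Pred S q} → (∀ b → P b → Q b) → Null Q → Null P
      null-⊆ P⊆Q = downward λ b b∈P → ∈-set⁺ (P⊆Q b (∈-set⁻ b∈P))

      null-∪ : ∀ {p q} {P : Pred S p} {Q : Pred S q} → Null P → Null Q → Null (λ b → P b ⊎ Q b)
      null-∪ {P = P} {Q} P-null Q-null = downward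
        (λ b b∈ → Equivalence.from T-∨ ([ inj₁ ∘ ∈-set⁺ , inj₂ ∘ ∈-set⁺ ]′ (∈-set⁻ b∈)))
        (unions P-null Q-null)

      ∈H⇒null : ∀ {A} → A ∈ H → Null (_∈ A)
      ∈H⇒null = downward λ b → ∈-set⁻

      null⇒∈H : ∀ {A} → Null (_∈ A) → A ∈ H
      null⇒∈H = downward λ b → ∈-set⁺

      somewhere-not : ∀ {p} {P : Pred S p} → Null P → ∃[ b ] ¬ P b
      somewhere-not P-null = byContradiction λ none → proper (downward
        (λ b _ → ∈-set⁺ (byContradiction λ ¬Pb → none (b , ¬Pb))) P-null)

      -- Smallness is measured by the ideal instead of by cardinality, which makes
      -- closure under dependent unions immediate.
      Small : ∀ {I : Set ℓ} → Pred I ℓ → Set (lsuc ℓ)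
      Small {I} Q = ∀ (N : I → Pred S ℓ) → (∀ y → Q y → Null (N y)) → Null (λ b → ∃[ y ] Q y × N y b)

      -- This is κ-completeness. Different ξ may give the same set, so an index is chosen for each
      -- member of the family; this injects the family into δ, hence κ does not inject into it.
      initial-small : ∀ {δ} → δ < κ → Small (_< δ)
      initial-small {δ} δ<κ N N-null = complete X X⊆H (X↣κ , κ↣̸X)
          (set Union) λ b → mk⇔
          (λ b∈ → let (ξ , ξ<δ , b∈N) = ∈-set⁻ {P = Union} b∈ in
            set (N ξ) , ∈-set⁺ (ξ , ξ<δ , refl) , ∈-set⁺ b∈N)
          (λ (A , A∈X , b∈A) → let (ξ , ξ<δ , A≡) = ∈-set⁻ {P = Indexed} A∈X in
            ∈-set⁺ (ξ , ξ<δ , ∈-set⁻ (subst (b ∈_) A≡ b∈A)))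
        where
        Union : Pred S ℓ
        Union b = ∃[ ξ ] ξ < δ × N ξ b
        Indexed : Pred (𝒫 S) ℓ
        Indexed A = ∃[ ξ ] ξ < δ × A ≡ set (N ξ)
        X : 𝒫 (𝒫 S)
        X = set Indexed
        index : (A : El X) → Indexed (value A)
        index A = ∈-set⁻ (holds A)
        X⊆H : X ⊆ H
        X⊆H A A∈X = let (ξ , ξ<δ , A≡) = ∈-set⁻ A∈X in subst (_∈ H) (sym A≡) (N-null ξ ξ<δ)
        index-injective : ∀ A B → proj₁ (index A) ≡ proj₁ (index B) → A ≡ B
        index-injective A B eq = value-injective
          (≡-trans (proj₂ (proj₂ (index A))) (≡-trans (cong (set ∘ N) eq) (sym (proj₂ (proj₂ (index B))))))
        X↣κ : El X ↣ ⟨ Λ ↓ κ ⟩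
        X↣κ = mk↣ {to = λ A → proj₁ (index A) , [ trans (proj₁ (proj₂ (index A))) δ<κ ]}
          λ {A} {B} eq → index-injective A B (cong value eq)
        κ↣̸X : ¬ (⟨ Λ ↓ κ ⟩ ↣ El X)
        κ↣̸X f = cardinal (δ , [ δ<κ ]) (mk↣
          {to = λ A → (proj₁ (index A) , [ trans (proj₁ (proj₂ (index A))) δ<κ ]) , [ proj₁ (proj₂ (index A)) ]}
          (λ {A} {B} eq → index-injective A B (cong (value ∘ value) eq)) ↣-∘ f)

      null-⊉ : ∀ (r : S) → Null (λ b → ¬ (value r ⊆ value b))
      null-⊉ r = fine _ (r , λ b r⊆b b∈ → ∈-set⁻ b∈ r⊆b)

      -- For γ < δ < κ, every b containing δ has trace above γ, and fineness makes the remaining b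
      -- null.
      null-τ≤ : ∀ γ → γ < κ → Null (λ b → τ b ≤ γ)
      null-τ≤ γ γ<κ = let (δ , δ<κ , γ<δ) = κ-unbounded γ γ<κ in
        fine _ ((singleton δ , [ subsingleton singleton-subsingleton ]) , λ b δ∈b b∈ →
          ≤⇒≯ (∈-set⁻ b∈)
            (Equivalence.from (τ-isTrace b γ) (δ , (δ∈b δ (∈-set⁺ refl) , δ<κ) , γ<δ)))

  -- Colour 0: homogeneous sets from generic points.

  module Colouring {ℓ} (Λ : Ordinal ℓ) (κ : ⟨ Λ ⟩) (cardinal : IsCardinal (Λ ↓ κ))
                   (ℕ↣κ : ℕ ↣ ⟨ Λ ↓ κ ⟩) (regular : IsRegular (Λ ↓ κ))
                   {H : 𝒫 (𝒫 (Pκλ Λ κ))} (ideal : IsIdealOnPκλ Λ κ H)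
                   (F : Refinement (⟨ Λ ⟩ × Pκλ Λ κ) (TracePairs Λ κ (λ _ → true)) → Bool) where
    open Order Λ
    open Traces Λ κ cardinal ℕ↣κ regular
    open IdealOn ideal
    private
      module K = Order (Λ ↓ κ)

    τK : S → ⟨ Λ ↓ κ ⟩
    τK b = τ b , [ τ<κ b ]

    abstract

      -- A total extension of `F`, so that colours can be spoken of without a proof that the pair
      -- lies in the domain.
      G : ⟨ Λ ⟩ → S → Bool
      G ξ b with em {P = TracePairs Λ κ (λ _ → true) (ξ , b)}
      ... | yes p = F ((ξ , b) , [ p ])
      ... | no _  = false

      F≡G : ∀ p → F p ≡ G (proj₁ (value p)) (proj₂ (value p))
      F≡G p with em {P = TracePairs Λ κ (λ _ → true) (value p)}
      ... | yes _ = refl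
      ... | no ¬p = contradiction (holds p) ¬p

    infix 4 _◁_
    _◁_ : Rel S ℓ
    r ◁ b = value r ⊆ value b × τ r < τ b × G (τ r) b ≡ true

    ◁⇒≺ : ∀ {r b} → r ◁ b → _≺_ Λ κ r b
    ◁⇒≺ {r} {b} (r⊆b , lt , _) = r⊆b , τ r , τ b , τ-isTrace r , τ-isTrace b , lt

    ≺⇒τ< : ∀ {r b} → _≺_ Λ κ r b → τ r < τ b
    ≺⇒τ< (_ , ξ , ζ , ξ-trace , ζ-trace , lt) = subst₂ _<_ (trace-unique ξ-trace) (trace-unique ζ-trace) lt

    constantly : ∀ {B i} → (∀ a b → a ∈ B → b ∈ B → τ a < τ b → G (τ a) b ≡ i) →
                 Constantly F i (TracePairs Λ κ B)
    constantly {i = i} G≡i p (b∈B , (a , a∈B , a-trace) , (ζ , b-trace , lt)) = ≡-trans (F≡G p)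
      (subst (λ ξ → G ξ (proj₂ (value p)) ≡ i) (sym (trace-unique a-trace))
        (G≡i a _ a∈B b∈B (subst₂ _<_ (trace-unique a-trace) (trace-unique b-trace) lt)))

    Homogeneous⁰ : 𝒫 S → Set ℓ
    Homogeneous⁰ A = ∃[ B ] B ⊆ A × ¬ (B ∈ H) × Constantly F false (TracePairs Λ κ B)

    -- If every bounded set of traces left a positive part of P uncovered, then
    -- a generic T ⊆ κ would make {b ∈ P : τ b ∈ T, b has colour 0 with T} a
    -- positive homogeneous set.

    module Generic (P : Pred S ℓ) (rep : ⟨ Λ ⟩ → S)
                   (rep-τ : ∀ b → P b → P (rep (τ b)) × τ (rep (τ b)) ≡ τ b) where

      -- One representative per trace is enough, as the colour depends on the first entry only
      -- through its trace; so only δ many points are consulted.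
      Uncovered : ⟨ Λ ⟩ → Pred S ℓ
      Uncovered δ b = P b × (∀ ξ → ξ < δ → P (rep ξ) → τ (rep ξ) ≡ ξ → ¬ (rep ξ ◁ b))

      Selected : Space (Λ ↓ κ) → Pred S ℓ
      Selected t b = P b × τK b ∈ t × (∀ a → P a → τ a < τ b → τK a ∈ t → G (τ a) b ≡ false)

      Meets : 𝒫 S → Pred (Space (Λ ↓ κ)) ℓ
      Meets C t = ∃[ b ] ¬ (b ∈ C) × Selected t b

      -- Whether t selects b depends only on t up to τ b, a part of κ of size less than κ.
      meets-open : ∀ C → IsOpen (Λ ↓ κ) (set (Meets C))
      meets-open C t t∈ =
        let (b , b∉C , Pb , τb∈t , colour) = ∈-set⁻ t∈
            (δ , τb<δ) = unbounded (τK b)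
            agrees : ∀ u → BasicOpen (Λ ↓ κ) (initial δ , λ x → t (value x)) u → ∀ ξ → ξ K.< δ → u ξ ≡ t ξ
            agrees u basic ξ ξ<δ = basic (ξ , [ ∈-set⁺ ξ<δ ])
        in (initial δ , λ x → t (value x)) , (λ _ → refl) , λ u basic → ∈-set⁺
             (b , b∉C , Pb , subst T (sym (agrees u basic (τK b) τb<δ)) τb∈t ,
              λ a Pa lt a∈u → colour a Pa lt (subst T (agrees u basic (τK a) (trans lt τb<δ)) a∈u))

      module _ (positive : ∀ δ → δ < κ → ¬ Null (Uncovered δ)) where

        -- A positive set is not covered by the null set `Bad`. A point b outside it contains all
        -- representatives with trace below δ and has a larger trace, so being uncovered can only
        -- mean colour 0 with those traces.
        avoid : ∀ C → C ∈ H → ∀ δ → δ < κ →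
                ∃[ b ] P b × ¬ (b ∈ C) × δ < τ b × (∀ a → P a → τ a < δ → G (τ a) b ≡ false)
        avoid C C∈H δ δ<κ =
          let (b , good) = byContradiction {P = ∃[ b ] Uncovered δ b × ¬ Bad b} λ none →
                positive δ δ<κ (null-⊆ (λ b u → byContradiction λ ¬bad → none (b , u , ¬bad))
                  (null-∪ (∈H⇒null C∈H) (null-∪ (null-τ≤ δ δ<κ)
                    (initial-small δ<κ (λ ξ b → ¬ (value (rep ξ) ⊆ value b)) (λ ξ _ → null-⊉ (rep ξ))))))
              ((Pb , uncovered) , ¬bad) = good
              δ<τb = byContradiction λ ≮ → ¬bad (inj₂ (inj₁ (≮⇒≥ ≮)))
          in b , Pb , ¬bad ∘ inj₁ , δ<τb , λ a Pa τa<δ →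
             let (Prep , τrep≡) = rep-τ a Pa
                 rep⊆b = byContradiction λ ⊈ → ¬bad (inj₂ (inj₂ (τ a , τa<δ , ⊈)))
             in ¬T⇒false λ coloured → uncovered (τ a) τa<δ Prep τrep≡
                  (rep⊆b , subst (_< τ b) (sym τrep≡) (trans τa<δ δ<τb) ,
                   subst (λ ξ → G ξ b ≡ true) (sym τrep≡) (Equivalence.to T-≡ coloured))
          where
          Bad : Pred S ℓ
          Bad b = b ∈ C ⊎ τ b ≤ δ ⊎ (∃[ ξ ] ξ < δ × ¬ (value (rep ξ) ⊆ value b))

        -- For a condition with domain bounded by δ, `avoid` gives b outside `C` with δ < τ b.
        -- Adding just τ b to the condition leaves below τ b only selected traces under δ, with
        -- which b has colour 0.
        meets-dense : ∀ C → C ∈ H → IsDense (Λ ↓ κ) (set (Meets C))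
        meets-dense C C∈H V V-open (t , t∈V) =
          u , proj₂ (proj₂ nbhd) u u-basic ,
          ∈-set⁺ (b , proj₁ (proj₂ (proj₂ pick)) , proj₁ (proj₂ pick) , ∈-set⁺ (inj₂ refl) , colour)
          where
          nbhd : ∃[ c ] BasicOpen (Λ ↓ κ) c t × (∀ g → BasicOpen (Λ ↓ κ) c g → g ∈ V)
          nbhd = V-open t t∈V
          dom : 𝒫< ⟨ Λ ↓ κ ⟩ ⟨ Λ ↓ κ ⟩
          dom = proj₁ (proj₁ nbhd)
          dom-bound : ∃[ δ ] (∀ ξ → ξ ∈ value dom → ξ K.< δ)
          dom-bound = bounded-subset (value dom) (proj₂ (holds dom))
          δ : ⟨ Λ ↓ κ ⟩
          δ = proj₁ dom-bound
          pick : ∃[ b ] P b × ¬ (b ∈ C) × value δ < τ b × (∀ a → P a → τ a < value δ → G (τ a) b ≡ false)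
          pick = avoid C C∈H (value δ) (holds δ)
          b : S
          b = proj₁ pick
          δ<τb : value δ < τ b
          δ<τb = proj₁ (proj₂ (proj₂ (proj₂ pick)))
          u : Space (Λ ↓ κ)
          -- All other places outside the domain get 0, lest a trace between δ and τ b be selected.
          u = set (λ ξ → ξ ∈ value dom × ξ ∈ t ⊎ ξ ≡ τK b)
          u-basic : BasicOpen (Λ ↓ κ) (proj₁ nbhd) u
          u-basic x = ≡-trans (T-injective
              (λ x∈u → [ proj₂ , (λ eq → contradiction (subst (K._< δ) eq (proj₂ dom-bound _ (holds x)))
                                           (λ lt → irrefl refl (trans lt δ<τb))) ]′ (∈-set⁻ x∈u))
              (λ x∈t → ∈-set⁺ (inj₁ (holds x , x∈t))))
            (proj₁ (proj₂ nbhd) x)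
          colour : ∀ a → P a → τ a < τ b → τK a ∈ u → G (τ a) b ≡ false
          colour a Pa lt a∈u = [ (λ (a∈dom , _) → proj₂ (proj₂ (proj₂ (proj₂ pick))) a Pa (proj₂ dom-bound _ a∈dom))
                               , (λ eq → contradiction lt (irrefl (cong value eq))) ]′ (∈-set⁻ a∈u)

        -- Some t lies in `Meets C` for all C in a generating family of size cof(H). Were
        -- `Selected t` in `H`, one such C would contain it, yet t selects a point outside C.
        homogeneous : ∀ {cofH covM : Set ℓ} → IsCof H cofH → IsCovM (Λ ↓ κ) covM → ¬ (covM ↣ cofH) →
                      ∀ {A} → (∀ b → P b → b ∈ A) → Homogeneous⁰ A
        homogeneous {cofH} {covM} ((X , (X⊆H , generates) , X⤖cofH) , _) isCovM covM↣̸cofH P⊆A =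
          set (Selected t) , (λ b b∈ → P⊆A b (proj₁ (∈-set⁻ b∈))) ,
          (λ selected∈H → let (C , C∈X , ⊆C) = Equivalence.to (generates _) selected∈H
                              (b , b∉C , selected) = ∈-set⁻ (meets (C , [ C∈X ]))
                          in b∉C (⊆C b (∈-set⁺ selected))) ,
          constantly λ a b a∈ b∈ lt →
            let (Pa , τa∈t , _) = ∈-set⁻ {P = Selected t} a∈ ; (_ , _ , colour) = ∈-set⁻ {P = Selected t} b∈
            in colour a Pa lt τa∈t
          where
          covM↣̸X : ¬ (covM ↣ El X)
          covM↣̸X f = covM↣̸cofH (mk↣ {to = Bijection.to X⤖cofH} (Bijection.injective X⤖cofH) ↣-∘ f)
          existence : ∃[ t ] (∀ (C : El X) → t ∈ set (Meets (value C)))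
          existence = generic isCovM covM↣̸X (λ C → set (Meets (value C)))
            (λ C → meets-open (value C)) (λ C → meets-dense (value C) (X⊆H _ (holds C)))
          t : Space (Λ ↓ κ)
          t = proj₁ existence
          meets : ∀ (C : El X) → t ∈ set (Meets (value C))
          meets = proj₂ existence

  -- Colour 1: the tree of increasing sequences.

  hasOrderType : ∀ {a b r} {A : Set a} {_R_ : Rel A r} (α : Ordinal b) (z : ⟨ α ⟩ → A) →
                 (∀ ξ η → Ordinal._<_ α ξ η → z ξ R z η) → (∀ ξ η → z ξ R z η → Ordinal._<_ α ξ η) →
                 (∀ x → ¬ (x R x)) → HasOrderType _R_ (set (λ x → ∃[ ξ ] z ξ ≡ x)) α
  hasOrderType {_R_ = _R_} α z mono cancel irr = index , record
    { isOrderMonomorphism = record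
      { isOrderHomomorphism = record
        { cong = cong index
        ; mono = λ {x} {y} xRy → cancel _ _ (subst₂ _R_ (sym (z-index x)) (sym (z-index y)) xRy)
        }
      ; injective = λ {x} {y} eq → value-injective (≡-trans (sym (z-index x)) (≡-trans (cong z eq) (z-index y)))
      ; cancel    = λ {x} {y} lt → subst₂ _R_ (z-index x) (z-index y) (mono _ _ lt)
      }
    ; surjective = λ ξ → (z ξ , [ ∈-set⁺ (ξ , refl) ]) , λ { refl → z-injective _ _ (z-index _) }
    }
    where
    B : 𝒫 _
    B = set (λ x → ∃[ ξ ] z ξ ≡ x)
    index : El B → ⟨ α ⟩
    index x = proj₁ (∈-set⁻ (holds x))
    z-index : ∀ x → z (index x) ≡ value x
    z-index x = proj₂ (∈-set⁻ (holds x))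
    z-injective : ∀ ξ η → z ξ ≡ z η → ξ ≡ η
    z-injective ξ η eq with Ordinal.compare α ξ η
    ... | tri< lt _ _ = contradiction (subst (z ξ R_) (sym eq) (mono ξ η lt)) (irr _)
    ... | tri≈ _ eq _ = eq
    ... | tri> _ _ gt = contradiction (subst (z η R_) eq (mono η ξ gt)) (irr _)

  module Tree {ℓ} (Λ : Ordinal ℓ) (κ θ : ⟨ Λ ⟩) (cardinal : IsCardinal (Λ ↓ κ))
              (ℕ↣κ : ℕ ↣ ⟨ Λ ↓ κ ⟩) (regular : IsRegular (Λ ↓ κ))
              (θ<κ : Ordinal._<_ Λ θ κ) (θ-cardinal : IsCardinal (Λ ↓ θ))
              (partition : (Λ ↓ κ) ⟶⟨κ, Λ ↓ θ ⟩²)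
              {H : 𝒫 (𝒫 (Pκλ Λ κ))} (ideal : IsIdealOnPκλ Λ κ H)
              {cofH covM : Set ℓ} (isCof : IsCof H cofH) (isCovM : IsCovM (Λ ↓ κ) covM)
              (covM↣̸cofH : ¬ (covM ↣ cofH))
              (F : Refinement (⟨ Λ ⟩ × Pκλ Λ κ) (TracePairs Λ κ (λ _ → true)) → Bool) where
    open Order Λ
    open Traces Λ κ cardinal ℕ↣κ regular
    open IdealOn ideal
    open Colouring Λ κ cardinal ℕ↣κ regular ideal F
    private
      module K = Order (Λ ↓ κ)

    -- The witness γ = τ b serves every b, so the union is all of P_κ(λ). This is how κ many indices
    -- are shown not to be small.
    κ-not-small : ¬ Null (λ b → ∃[ γ ] τ b ≤ value {P = λ x → x < κ} γ)
    κ-not-small null = let (b , none) = somewhere-not null in none (τK b , inj₂ refl)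

    module _ {A : 𝒫 S} (A-positive : ¬ (A ∈ H)) (noHomogeneous : ¬ Homogeneous⁰ A) where

      -- An arbitrary point: the default of choices and, through `null-⊉ b₀`, the source of a null
      -- set containing the empty one.
      b₀ : S
      b₀ = singleton κ , [ subsingleton singleton-subsingleton ]

      Seq : ⟨ Λ ⟩ → Set ℓ
      Seq i = ⟨ Λ ↓ i ⟩ → S

      -- With the proof irrelevant, restrictions along different proofs are definitionally equal.
      restr : ∀ {i j} → .(i ≤ j) → Seq j → Seq i
      restr i≤j y k = y (value k , [ <-≤-trans (holds k) i≤j ])

      Cone : ∀ {i} → Seq i → Pred S ℓ
      Cone y b = b ∈ A × (∀ j → y j ◁ b)

      rep : ∀ {i} → Seq i → ⟨ Λ ⟩ → S
      rep y ξ = chooseOr b₀ (λ r → Cone y r × τ r ≡ ξ)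

      rep-τ : ∀ {i} (y : Seq i) b → Cone y b → Cone y (rep y (τ b)) × τ (rep y (τ b)) ≡ τ b
      rep-τ y b Cb = chooseOr-satisfies b₀ (λ r → Cone y r × τ r ≡ τ b) (b , Cb , refl)

      module _ {i} (y : Seq i) where
        open Generic (Cone y) (rep y) (rep-τ y) public using (Uncovered)
        open Generic (Cone y) (rep y) (rep-τ y) using (homogeneous)

        abstract

          -- `Cone y` is a part of `A`, which has no positive subset homogeneous for 0, so
          -- `Uncovered δ` cannot be positive for all δ < κ. Here cof(H) < cov(M) enters the tree.
          cut : Σ[ δ ∈ ⟨ Λ ⟩ ] δ < κ × Null (Uncovered δ)
          cut = byContradiction λ none → noHomogeneous
            (homogeneous (λ δ δ<κ null → none (δ , δ<κ , null)) isCof isCovM covM↣̸cofH (λ b → proj₁))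

        -- The equation with `rep` admits one child per trace, so children are indexed by the traces
        -- below the cut.
        Child : Pred S ℓ
        Child r = τ r < proj₁ cut × r ≡ rep y (τ r) × Cone y r

        children-small : Small Child
        children-small N N-null = null-⊆
          (λ { b (r , child@(r<δ , r≡rep , _) , b∈N) →
               τ r , r<δ , subst Child r≡rep child , subst (λ r → N r b) r≡rep b∈N })
          (initial-small (proj₁ (proj₂ cut)) (λ ξ b → Child (rep y ξ) × N (rep y ξ) b)
            (λ ξ _ → byCases ξ em))
          where
          byCases : ∀ ξ → Dec (Child (rep y ξ)) → Null (λ b → Child (rep y ξ) × N (rep y ξ) b)
          byCases ξ (yes child) = null-⊆ (λ _ → proj₂) (N-null _ child)
          -- A trace without a child contributes the empty set.
          byCases ξ (no ¬child) = null-⊆ (λ _ (child , _) → contradiction child ¬child) (null-⊉ b₀)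

      child-unique : ∀ {i} (y : Seq i) {r s} → Child y r → Child y s → τ r ≡ τ s → r ≡ s
      child-unique y (_ , r≡rep , _) (_ , s≡rep , _) eq = ≡-trans r≡rep (≡-trans (cong (rep y) eq) (sym s≡rep))

      Next : ∀ {i} → Seq i → S → Pred S ℓ
      Next y b r = Child y r × r ◁ b

      module _ (b : S) where
        private
          -- At each level b moves to a child of its own prefix lying ◁-below b. If there is none,
          -- the default is taken and later values carry no meaning; `GoodBelow` excludes this.
          branch-recursion : Σ[ x ∈ (⟨ Λ ⟩ → S) ] (∀ i → x i ≡ chooseOr b₀ (Next {i} (λ j → x (value j)) b))
          branch-recursion = recursion wellFounded (λ i ih → chooseOr b₀ (Next {i} (λ j → ih (value j) (holds j)) b))

        branch : ⟨ Λ ⟩ → S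
        branch = proj₁ branch-recursion

        prefix : ∀ i → Seq i
        prefix i j = branch (value j)

        Extends : ⟨ Λ ⟩ → Set ℓ
        Extends i = Next (prefix i) b (branch i)

        extends : ∀ i r → Next (prefix i) b r → Extends i
        extends i r next = subst (Next (prefix i) b) (sym (proj₂ branch-recursion i)) (chooseOr-satisfies b₀ _ (r , next))

        GoodBelow : ⟨ Λ ⟩ → Set ℓ
        GoodBelow i = ∀ j → j < i → Extends j

        cone : ∀ i → b ∈ A → GoodBelow i → Cone (prefix i) b
        cone i b∈A good = b∈A , λ j → proj₂ (good (value j) (holds j))

      Node : ∀ i → Pred (Seq i) ℓ
      Node i y = ∃[ b ] b ∈ A × GoodBelow b i × y ≡ prefix b i

      node-child : ∀ {i j} (j<i : j < i) {y} → Node i y →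
                    Node j (restr (inj₁ j<i) y) × Child (restr (inj₁ j<i) y) (y (j , [ j<i ]))
      node-child {j = j} j<i (b , b∈A , good , refl) =
        (b , b∈A , (λ k k<j → good k (trans k<j j<i)) , refl) , proj₁ (good j j<i)

      -- A point whose branch stops at i lies in the cone of its prefix but above none of the
      -- children, so in the null set left over by `cut`. There is one such null set per node.
      stuck-null : ∀ i → Small (Node i) → Null (λ b → b ∈ A × GoodBelow b i × ¬ Extends b i)
      stuck-null i small = null-⊆ uncovered (small (λ y → Uncovered y (proj₁ (cut y))) (λ y _ → proj₂ (proj₂ (cut y))))
        where
        uncovered : ∀ b → b ∈ A × GoodBelow b i × ¬ Extends b i →
                    ∃[ y ] Node i y × Uncovered y (proj₁ (cut y)) b
        uncovered b (b∈A , good , ¬extends) = prefix b i , (b , b∈A , good , refl) , cone b i b∈A good ,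
          λ ξ ξ<δ Crep τrep≡ξ rep◁b → ¬extends (extends b i _
            ((subst (_< _) (sym τrep≡ξ) ξ<δ , cong (rep (prefix b i)) (sym τrep≡ξ) , Crep) , rep◁b))

      bad-null : ∀ {i} → i < κ → (∀ j → j < i → Small (Node j)) → Null (λ b → b ∈ A × ¬ GoodBelow b i)
      bad-null {i} i<κ small = null-⊆ firstBad
        (initial-small i<κ (λ j b → b ∈ A × GoodBelow b j × ¬ Extends b j) (λ j j<i → stuck-null j (small j j<i)))
        where
        firstBad : ∀ b → b ∈ A × ¬ GoodBelow b i → ∃[ j ] j < i × (b ∈ A × GoodBelow b j × ¬ Extends b j)
        firstBad b (b∈A , bad) =
          let (j , (j<i , ¬extends) , before) = least wellFounded {P = λ j → j < i × ¬ Extends b j}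
                (byContradiction λ none → bad λ j j<i → byContradiction λ ¬e → none (j , j<i , ¬e))
          in j , j<i , b∈A , (λ k k<j → byContradiction λ ¬e → before k k<j (trans k<j j<i , ¬e)) , ¬extends

      -- As j is the last level below i, a node of level i amounts to a node of level j with one of
      -- its children.
      successor-nodes-small : ∀ {i j} → j < i → (∀ k → k < i → k ≤ j) → Small (Node j) → Small (Node i)
      successor-nodes-small {i} {j} j<i last small N N-null = null-⊆
          (λ { b (y , y∈ , b∈N) → let (u∈ , child) = node-child j<i y∈ in
               restr (inj₁ j<i) y , u∈ , _ , child , y , y∈ , refl , refl , b∈N })
          (small _ λ u _ → children-small u _ λ r _ → onlyOne u r em)
        where
        Over : Seq j → S → Pred (Seq i) ℓ
        Over u r y = Node i y × restr (inj₁ j<i) y ≡ u × y (j , [ j<i ]) ≡ r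
        over-unique : ∀ {u r y y′} → restr (inj₁ j<i) y ≡ u × y (j , [ j<i ]) ≡ r →
                      restr (inj₁ j<i) y′ ≡ u × y′ (j , [ j<i ]) ≡ r → y ≡ y′
        over-unique {y = y} {y′} (u≡ , r≡) (u≡′ , r≡′) = ext λ k → agree k (last (value k) (holds k))
          where
          agree : ∀ k → value k ≤ j → y k ≡ y′ k
          agree k (inj₁ k<j)  = cong (λ u → u (value k , [ k<j ])) (≡-trans u≡ (sym u≡′))
          agree k (inj₂ refl) = ≡-trans r≡ (sym r≡′)
        onlyOne : ∀ u r → Dec (∃ (Over u r)) →
          Null (λ b → ∃[ y ] Node i y × restr (inj₁ j<i) y ≡ u × y (j , [ j<i ]) ≡ r × N y b)
        onlyOne u r (no none) = null-⊆ (λ _ (y , y∈ , u≡ , r≡ , _) → contradiction (y , y∈ , u≡ , r≡) none) (null-⊉ b₀)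
        onlyOne u r (yes (y , y∈ , over)) = null-⊆
          (λ { b (y′ , _ , u≡ , r≡ , b∈N) → subst (λ y → N y b) (over-unique (u≡ , r≡) over) b∈N })
          (N-null y y∈)

      module _ {i} (i<θ : i < θ) (noLast : ∀ j → j < i → ∃[ k ] k < i × j < k)
               (small : ∀ j → j < i → Small (Node j)) where

        -- At the first difference both entries are children of the same node, and those are told
        -- apart by their traces. So nodes can be compared as sequences of ordinals.
        distinct : ∀ {y y′} → Node i y → Node i y′ → y ≢ y′ → ∃[ j ] τ (y j) ≢ τ (y′ j)
        distinct {y} {y′} y∈ y′∈ y≢y′ = byContradiction λ same → y≢y′ (ext λ j →
            byContradiction λ differ → firstDifference same
              (least (Ordinal.wellFounded (Λ ↓ i)) {P = λ j → y j ≢ y′ j} (j , differ)))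
          where
          firstDifference : ¬ (∃[ j ] τ (y j) ≢ τ (y′ j)) →
            ¬ (∃[ j ] y j ≢ y′ j × (∀ k → value k < value j → ¬ (y k ≢ y′ k)))
          firstDifference same (j , differ , before) = differ (child-unique _
            (proj₂ (node-child (holds j) y∈))
            (subst (λ u → Child u (y′ j)) (sym agree) (proj₂ (node-child (holds j) y′∈)))
            (byContradiction λ τ≢ → same (j , τ≢)))
            where
            agree : restr (inj₁ (holds j)) y ≡ restr (inj₁ (holds j)) y′
            agree = ext λ k → byContradiction (before _ (holds k))

        -- Otherwise κ many distinct nodes can be listed. `splittingPoints` finds κ many among them,
        -- each determined by a level below i and its restriction through that level. This injects κ
        -- into pairs of a lower node and a child, which are small.
        limit-nodes-small : Small (Node i)
        limit-nodes-small = byContradiction λ ¬small →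
          let (e , e∈ , e-injective) = greedy (Ordinal.wellFounded (Λ ↓ κ)) (λ _ → b₀) K.≢⇒<⊎> (fresh ¬small)
              -- Level 0 has no last element below it either. Two different nodes provide an element
              -- of i, so that i is infinite.
              j₀ = proj₁ (distinct (e∈ (to ℕ↣κ 0)) (e∈ (to ℕ↣κ 1))
                     (λ eq → contradiction (injective ℕ↣κ (e-injective eq)) λ ()))
              (z , j , j-injective) = splittingPoints Λ κ θ i<θ θ-cardinal 
                (Order.noLast⇒ℕ↣ (Λ ↓ i) j₀ λ k → let (l , l<i , k<l) = noLast (value k) (holds k) in (l , [ l<i ]) , k<l)
                partition unbounded (λ α k → τ (e α k))
                (λ α β α≢β → distinct (e∈ α) (e∈ β) (α≢β ∘ e-injective))
          in injection⇒⊥ (e ∘ z) (e∈ ∘ z) j j-injective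
          where
          -- If the nodes were exhausted before stage α, they would be indexed by an initial segment
          -- of κ and hence be small.
          fresh : ¬ Small (Node i) → ∀ α (e : ⟨ Λ ↓ κ ⟩ → Seq i) →
                  ∃[ y ] Node i y × (∀ β → β K.< α → e β ≢ y)
          fresh ¬small α e = byContradiction λ none → ¬small λ N N-null → null-⊆
            (λ { b (y , y∈ , b∈N) →
                 let (β , β<α , eβ≡y) = byContradiction {P = ∃[ β ] β K.< α × e β ≡ y} λ ¬β →
                       none (y , y∈ , λ β β<α eq → ¬β (β , β<α , eq))
                 in value β , β<α , β , refl , subst (Node i) (sym eβ≡y) y∈ , subst (λ y → N y b) (sym eβ≡y) b∈N })
            (initial-small (holds α) (λ ξ b → ∃[ β ] value β ≡ ξ × Node i (e β) × N (e β) b)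
              (λ ξ ξ<α → byCases e N N-null ξ em))
            where
            byCases : ∀ (e : ⟨ Λ ↓ κ ⟩ → Seq i) N → (∀ y → Node i y → Null (N y)) →
                      ∀ ξ → Dec (∃[ β ] value {P = λ x → x < κ} β ≡ ξ × Node i (e β)) →
                      Null (λ b → ∃[ β ] value {P = λ x → x < κ} β ≡ ξ × Node i (e β) × N (e β) b)
            byCases e N N-null ξ (yes (β , refl , y∈)) = null-⊆
              (λ { b (β′ , eq , _ , b∈N) → subst (λ β → N (e β) b) (value-injective eq) b∈N }) (N-null _ y∈)
            byCases e N N-null ξ (no none) = null-⊆
              (λ { b (β , eq , y∈ , _) → contradiction (β , eq , y∈) none }) (null-⊉ b₀)

          -- Such an injection of κ into a small set would make P_κ(λ) null,
          -- being the union of the null sets {b : τ b ≤ γ}.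
          injection⇒⊥ : (y : ⟨ Λ ↓ κ ⟩ → Seq i) → (∀ γ → Node i (y γ)) → (j : ⟨ Λ ↓ κ ⟩ → ⟨ Λ ↓ i ⟩) →
            ¬ (∀ γ γ′ → j γ ≡ j γ′ → (∀ k → value k ≤ value (j γ) → τ (y γ k) ≡ τ (y γ′ k)) → γ ≡ γ′)
          injection⇒⊥ y y∈ j j-injective = κ-not-small (null-⊆
              (λ { b (γ , τb≤γ) → let (u∈ , child) = node-child (holds (j γ)) (y∈ γ) in
                   value (j γ) , holds (j γ) , restr (inj₁ (holds (j γ))) (y γ) , u∈ , y γ (j γ) , child ,
                   γ , (refl , (λ _ _ → refl) , refl) , τb≤γ })
              -- The union runs over levels k, nodes u of level k and children r of u; at most one γ
              -- belongs to each triple.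
              (initial-small (trans i<θ θ<κ) _ λ k k<i → small k k<i _ λ u _ → children-small u _ λ r _ → onlyOne k u r em))
            where
            -- Agreement with u is stated pointwise, which avoids a transport along
            -- `value (j γ) ≡ k`.
            Over : ∀ k → Seq k → S → Pred ⟨ Λ ↓ κ ⟩ ℓ
            Over k u r γ = value (j γ) ≡ k ×
              (∀ (l : ⟨ Λ ↓ k ⟩) (l<i : value l < i) → y γ (value l , [ l<i ]) ≡ u l) × y γ (j γ) ≡ r
            over-unique : ∀ {k u r γ γ′} → Over k u r γ → Over k u r γ′ → γ ≡ γ′
            over-unique {γ = γ} {γ′} (k≡ , u≡ , r≡) (k≡′ , u≡′ , r≡′) = j-injective γ γ′ jγ≡jγ′ λ l l≤ → cong τ (agree l l≤)
              where
              jγ≡jγ′ : j γ ≡ j γ′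
              jγ≡jγ′ = value-injective (≡-trans k≡ (sym k≡′))
              agree : ∀ l → value l ≤ value (j γ) → y γ l ≡ y γ′ l
              agree l (inj₁ l<) = let l′ = value l , [ subst (value l <_) k≡ l< ] in
                ≡-trans (u≡ l′ (holds l)) (sym (u≡′ l′ (holds l)))
              agree l (inj₂ l≡) = ≡-trans (cong (y γ) (value-injective l≡))
                (≡-trans r≡ (≡-trans (sym r≡′) (cong (y γ′) (sym (≡-trans (value-injective l≡) jγ≡jγ′)))))
            onlyOne : ∀ k u r → Dec (∃ (Over k u r)) → Null (λ b → ∃[ γ ] Over k u r γ × τ b ≤ value γ)
            onlyOne k u r (no none) = null-⊆ (λ _ (γ , over , _) → contradiction (γ , over) none) (null-⊉ b₀)
            onlyOne k u r (yes (γ , over)) = null-⊆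
              (λ { b (γ′ , over′ , le) → subst (λ γ → τ b ≤ value γ) (over-unique over′ over) le })
              (null-τ≤ (value γ) (holds γ))

      nodes-small : ∀ i → i < θ → Small (Node i)
      nodes-small = All.wfRec wellFounded _ _ λ i ih i<θ → step i (λ j j<i → ih j<i (trans j<i i<θ)) i<θ em
        where
        step : ∀ i → (∀ j → j < i → Small (Node j)) → i < θ →
               Dec (∃[ j ] j < i × (∀ k → k < i → k ≤ j)) → Small (Node i)
        step i small i<θ (yes (j , j<i , last)) = successor-nodes-small j<i last (small j j<i)
        -- Here i is 0 or a limit.
        step i small i<θ (no noLast) = limit-nodes-small i<θ
          (λ j j<i → byContradiction λ ¬k → noLast (j , j<i , λ k k<i → ≮⇒≥ λ j<k → ¬k (k , k<i , j<k))) small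

      -- The points of `A` whose branch breaks off below θ form a null set, and `A` is positive.
      goodPoint : ∃[ b ] b ∈ A × GoodBelow b θ
      goodPoint = byContradiction λ none → A-positive (null⇒∈H (null-⊆
        (λ b b∈A → b∈A , λ good → none (b , b∈A , good)) (bad-null θ<κ nodes-small)))

      -- Every entry of the branch of a good point b lies in the cone of the entries before it, and
      -- b lies above them all; ◁ includes colour 1.
      chain : Σ[ B ∈ 𝒫 S ] B ⊆ A × HasOrderType (_≺_ Λ κ) B (Λ ↓+1 θ) × Constantly F true (TracePairs Λ κ B)
      chain = set (λ a → ∃[ ξ ] z ξ ≡ a) ,
        (λ a a∈ → let (ξ , zξ≡a) = ∈-set⁻ a∈ in subst (_∈ A) zξ≡a (z∈A ξ)) ,
        hasOrderType (Λ ↓+1 θ) z (λ ξ η ξ<η → ◁⇒≺ (z-mono ξ η ξ<η)) (λ ξ η lt → z-cancel ξ η (≺⇒τ< lt))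
          (λ a lt → irrefl {τ a} refl (≺⇒τ< lt)) ,
        constantly λ a c a∈ c∈ lt → coloured (∈-set⁻ a∈) (∈-set⁻ c∈) lt
        where
        b : S
        b = proj₁ goodPoint
        b∈A : b ∈ A
        b∈A = proj₁ (proj₂ goodPoint)
        good : GoodBelow b θ
        good = proj₂ (proj₂ goodPoint)
        at : ∀ ξ → Dec (ξ < θ) → S
        at ξ (yes _) = branch b ξ
        -- The only index in θ + 1 not below θ is θ itself, the place of b.
        at ξ (no _)  = b
        z : ⟨ Λ ↓+1 θ ⟩ → S
        z ξ = at (value ξ) em
        at∈A : ∀ ξ d → at ξ d ∈ A
        at∈A ξ (yes ξ<θ) = proj₁ (proj₂ (proj₂ (proj₁ (good ξ ξ<θ))))
        at∈A ξ (no _)    = b∈A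
        z∈A : ∀ ξ → z ξ ∈ A
        z∈A ξ = at∈A (value ξ) em
        at-mono : ∀ ξ η d e → ξ < η → η ≤ θ → at ξ d ◁ at η e
        at-mono ξ η (yes ξ<θ) (yes η<θ) ξ<η _ = proj₂ (proj₂ (proj₂ (proj₁ (good η η<θ)))) (ξ , [ ξ<η ])
        at-mono ξ η (yes ξ<θ) (no _)    _   _ = proj₂ (good ξ ξ<θ)
        at-mono ξ η (no ξ≮θ)  _ ξ<η η≤θ       = contradiction (<-≤-trans ξ<η η≤θ) ξ≮θ
        z-mono : ∀ ξ η → value ξ < value η → z ξ ◁ z η
        z-mono ξ η ξ<η = at-mono (value ξ) (value η) em em ξ<η (holds η)
        z-cancel : ∀ ξ η → τ (z ξ) < τ (z η) → value ξ < value η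
        z-cancel ξ η lt with compare (value ξ) (value η)
        ... | tri< ξ<η _ _ = ξ<η
        ... | tri≈ _ eq _  = contradiction lt (irrefl (cong (λ ξ → τ (z ξ)) (value-injective {v = ξ} {w = η} eq)))
        ... | tri> _ _ η<ξ = contradiction (trans lt (proj₁ (proj₂ (z-mono η ξ η<ξ)))) (irrefl {τ (z ξ)} refl)
        coloured : ∀ {a c} → ∃[ ξ ] z ξ ≡ a → ∃[ η ] z η ≡ c → τ a < τ c → G (τ a) c ≡ true
        coloured (ξ , refl) (η , refl) lt = proj₂ (proj₂ (z-mono ξ η (z-cancel ξ η lt)))

theorem10p5 : (∀ {a} → ExcludedMiddle a) →
    (∀ {a b} → Extensionality a b) →
    ∀ {ℓ} (Λ : Ordinal ℓ) (κ θ : ⟨ Λ ⟩) →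
    IsCardinal Λ →
    IsUncountableCardinal (Λ ↓ κ) →
    IsRegular (Λ ↓ κ) →
    Ordinal._<_ Λ θ κ →
    IsInfiniteCardinal (Λ ↓ θ) →
    (Λ ↓ κ) ⟶⟨κ, Λ ↓ θ ⟩² →
    ∀ (H : 𝒫 (𝒫 (Pκλ Λ κ))) →
    IsIdealOnPκλ Λ κ H →
    (cofH covM : Set ℓ) →
    IsCof H cofH →
    IsCovM (Λ ↓ κ) covM →
    cofH ⟪ covM →
    _⁺⟶⟨H⁺,_⟩² Λ κ H (Λ ↓+1 θ)
theorem10p5 em ext {ℓ} Λ κ θ _ (κ-cardinal , ℕ↣κ , _) regular θ<κ (θ-cardinal , _) partition H ideal
            cofH covM isCof isCovM (_ , covM↣̸cofH) F A A∉H = byCases em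
  where
  open Classical em ext
  open Colouring Λ κ κ-cardinal ℕ↣κ regular ideal F using (Homogeneous⁰)
  open Tree Λ κ θ κ-cardinal ℕ↣κ regular θ<κ θ-cardinal partition ideal isCof isCovM covM↣̸cofH F using (chain)
  byCases : Dec (Homogeneous⁰ A) →
    ∃[ B ] B ⊆ A × ((¬ (B ∈ H) × Constantly F false (TracePairs Λ κ B))
                  ⊎ (HasOrderType (_≺_ Λ κ) B (Λ ↓+1 θ) × Constantly F true (TracePairs Λ κ B)))
  byCases (yes (B , B⊆A , homogeneous)) = B , B⊆A , inj₁ homogeneous
  byCases (no none)                     = let (B , B⊆A , homogeneous) = chain A∉H none in B , B⊆A , inj₂ homogeneous
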